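{- Let $n,m\geq 1$. Define a map $\Phi$ from $\mathscr H_m(n)$ to the set of $(2m+1)$-historic trees on $n$ vertices recursively: $\Phi(T_1)$ is the one-vertex historic tree (vertex labelled $1$); if $\Phi(T_1,\dots,T_k)=H_k$ has been constructed and $T_{k+1}$ arises from $T_k$ by inserting a key into the $i$-th leaf of $T_k$ (counted from left to right, before any splits are performed), then $\Phi(T_1,\dots,T_{k+1})=H_{k+1}$ is obtained from $H_k$ by placing a new vertex labelled $k+1$ at the $i$-th external vertex of $H_k$ (counted from left to right). Then $\Phi$ is well defined (in particular, for every $k$ the number of external vertices of $H_k$ equals the number of leaves of $T_k$), and $\Phi$ is a bijection between $\mathscr H_m(n)$ and the set of all $(2m+1)$-historic trees on $n$ vertices.
   Context: Fix an integer $m\geq 1$. A $B$-tree of order $2m+1$ is a rooted plane tree whose nodes contain pairwise distinct real keys such that: keys are stored in increasing order from left to right; a non-leaf node with $k$ keys has exactly $k+1$ children, the $i$-th child being attached between the $(i-1)$-th and $i$-th key of the node (the first child to the left of the first key, the last to the right of the last key), with all keys in the subtree of that child lying between those two keys; every node contains between $m$ and $2m$ keys, except the root, which contains between $1$ and $2m$ keys; and all leaves have the same distance to the root. Insertion algorithm: a new key is placed in the appropriate leaf at the appropriate position; if that leaf now has $2m+1$ keys, it is split: its median key moves up into the parent node (at the appropriate position), and the $m$ smallest and the $m$ largest keys form two new nodes, which become the children of the parent on either side of the moved key; this is repeated at the parent if it now contains $2m+1$ keys; if the root gets $2m+1$ keys, a new root containing only its median key is created above it, with the two halves as its children. $B$-trees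 are considered up to isomorphism of rooted plane trees (only the shape and the number of keys in each node matter); leaves are numbered from left to right. A history of a $B$-tree $T_n$ with $n$ keys is a sequence $(T_1,\dots,T_n)$ of $B$-trees of order $2m+1$ such that $T_1$ is the single node containing one key and $T_i$ is obtained from $T_{i-1}$ by inserting one key with the insertion algorithm ($i=2,\dots,n$). $\mathscr H_m(n)$ denotes the set of all histories of all $B$-trees of order $2m+1$ with $n$ keys. A $(2m+1)$-historic tree on $n$ vertices is a rooted plane tree whose $n$ vertices are labelled bijectively by $\{1,\dots,n\}$ so that labels increase along every path from the root to a leaf, and such that (with the root at height $0$) the vertices at heights $2m,3m+1,4m+2,\dots$ (i.e. heights $2m+j(m+1)$, $j\geq 0$), called branchings, have two ordered child slots (left and right), each of which may or may not be occupied by a child, while every other vertex has a single child slot (so at most one child). The vertices of the tree are called internal; the unoccupied child slots are called external vertices, ordered from left to right by the planar structure. -}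

module Defs where

open import Data.Bool.Base using (if_then_else_)
open import Data.Fin.Base using (Fin; zero; suc; toℕ; splitAt; _↑ˡ_; _↑ʳ_)
open import Data.List.Base as List using (List; []; _∷_; _++_; length; take; drop; applyUpTo)
open import Data.List.Relation.Binary.Permutation.Propositional using (_↭_)
open import Data.List.Relation.Unary.All using (All)
open import Data.List.Relation.Unary.AllPairs using (AllPairs)
open import Data.Maybe.Base using (Maybe; just; nothing)
open import Data.Nat.Base using (ℕ; zero; suc; _+_; _*_; _∸_; _≤_; _<_)
open import Data.Nat.Divisibility using (_∣_; _∣?_; divides)
open import Data.Nat.Properties using (_≤?_; m≤m+n; m+n∸m≡n; m+[n∸m]≡n)
open import Data.Product.Base using (Σ-syntax; ∃-syntax; _×_; _,_; proj₁; proj₂)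
open import Data.Sum.Base using (inj₁; inj₂)
open import Data.Unit.Base using (⊤; tt)
open import Data.Vec.Base as Vec using (Vec; []; _∷_)
open import Data.Vec.Relation.Unary.All using () renaming (All to VecAll)
open import Level using (0ℓ; _⊔_) renaming (suc to lsuc)
open import Relation.Binary.Bundles using (Setoid; DenseLinearOrder; StrictTotalOrder)
import Relation.Binary.Construct.On as On
open import Relation.Binary.PropositionalEquality using (_≡_; refl; trans; sym; cong)
import Relation.Binary.PropositionalEquality as ≡
open import Relation.Nullary using (¬_; Dec; yes; no; does)
open import Relation.Nullary.Decidable using (map′; _×-dec_)

-- The keys are drawn from an arbitrary linear order having the properties
-- of (ℝ, <) that matter for inserting keys: it is non-empty, dense, and has
-- neither a least nor a greatest element.

record KeyOrder c ℓ₁ ℓ₂ : Set (lsuc (c ⊔ ℓ₁ ⊔ ℓ₂)) where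
  field
    denseLinearOrder : DenseLinearOrder c ℓ₁ ℓ₂

  open DenseLinearOrder denseLinearOrder public
    using (strictTotalOrder)
    renaming (Carrier to Key; _<_ to _<ₖ_; _≈_ to _≈ₖ_)
  open StrictTotalOrder strictTotalOrder public
    using () renaming (_<?_ to _<ₖ?_)

  field
    key        : Key
    noLeast    : ∀ x → ∃[ y ] y <ₖ x
    noGreatest : ∀ x → ∃[ y ] x <ₖ y

------------------------------------------------------------------------
-- B-trees

-- `node c ((k₁ , c₁) ∷ … ∷ (kₗ , cₗ) ∷ [])` is the node with keys k₁ … kₗ
-- and children c , c₁ , … , cₗ.

data Tree {a} (A : Set a) : Set a where
  leaf : List A → Tree A
  node : Tree A → List (A × Tree A) → Tree A

module _ {a} {A : Set a} where

  mutual
    keys : Tree A → List A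
    keys (leaf ks)  = ks
    keys (node c f) = keys c ++ keys* f

    keys* : List (A × Tree A) → List A
    keys* []            = []
    keys* ((k , d) ∷ f) = k ∷ keys d ++ keys* f

  mutual
    leaves : Tree A → ℕ
    leaves (leaf _)   = 1
    leaves (node c f) = leaves* c f

    leaves* : Tree A → List (A × Tree A) → ℕ
    leaves* c []            = leaves c
    leaves* c ((_ , d) ∷ f) = leaves c + leaves* d f

  -- Isomorphism classes of rooted plane trees with a number of keys in each
  -- node are represented by the trees with all keys erased.
  mutual
    shape : Tree A → Tree ⊤
    shape (leaf ks)  = leaf (List.map (λ _ → tt) ks)
    shape (node c f) = node (shape c) (shape* f)

    shape* : List (A × Tree A) → List (⊤ × Tree ⊤)
    shape* []            = []
    shape* ((_ , d) ∷ f) = (tt , shape d) ∷ shape* f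

  data LeavesAtDepth : ℕ → Tree A → Set a where
    leaf : ∀ {ks} → LeavesAtDepth 0 (leaf ks)
    node : ∀ {h c f} → LeavesAtDepth h c → All (λ (_ , d) → LeavesAtDepth h d) f →
           LeavesAtDepth (suc h) (node c f)

  -- The root has between l and 2m keys, every other node between m and 2m.
  data NodeSizes (m l : ℕ) : Tree A → Set a where
    leaf : ∀ {ks} → l ≤ length ks → length ks ≤ 2 * m → NodeSizes m l (leaf ks)
    node : ∀ {c f} → l ≤ length f → length f ≤ 2 * m →
           NodeSizes m m c → All (λ (_ , d) → NodeSizes m m d) f →
           NodeSizes m l (node c f)

module BTrees {c ℓ₁ ℓ₂} (K : KeyOrder c ℓ₁ ℓ₂) (m : ℕ) where

  open KeyOrder K public using (Key; _<ₖ_; _≈ₖ_; _<ₖ?_)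

  mutual
    Ordered : Tree Key → Set (c ⊔ ℓ₂)
    Ordered (leaf ks)  = AllPairs _<ₖ_ ks
    Ordered (node c f) = AllPairs _<ₖ_ (List.map proj₁ f) × Ordered* c f

    Ordered* : Tree Key → List (Key × Tree Key) → Set (c ⊔ ℓ₂)
    Ordered* c []            = Ordered c
    Ordered* c ((k , d) ∷ f) =
      Ordered c × All (_<ₖ k) (keys c) × All (k <ₖ_) (keys d) × Ordered* d f

  record IsBTree (t : Tree Key) : Set (c ⊔ ℓ₂) where
    field
      ordered       : Ordered t
      nodeSizes     : NodeSizes m 1 t
      leavesAtDepth : ∃[ h ] LeavesAtDepth h t

  record BTree : Set (c ⊔ ℓ₂) where
    field
      tree    : Tree Key
      isBTree : IsBTree tree
  open BTree public

  _≅_ : BTree → BTree → Set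
  T ≅ T′ = shape (tree T) ≡ shape (tree T′)

  ----------------------------------------------------------------------
  -- Insertion

  -- A list with more than 2m entries is split into its first m entries, the
  -- next entry, and the remaining ones (the result `nothing` means that no
  -- split is needed).
  splitMedian : ∀ {a} {A : Set a} → List A → Maybe (List A × A × List A)
  splitMedian {A = A} xs = if does (length xs ≤? 2 * m) then nothing else atMedian (drop m xs)
    where
    atMedian : List A → Maybe (List A × A × List A)
    atMedian []       = nothing
    atMedian (y ∷ ys) = just (take m xs , y , ys)

  -- The outcome of inserting a key into a subtree: either a subtree again, or
  -- two subtrees together with the key that moves up between them.
  data Outcome : Set c where
    intact : Tree Key → Outcome
    split  : Tree Key → Key → Tree Key → Outcome

  splitLeaf : List Key → Outcome
  splitLeaf ks with splitMedian ks
  ... | nothing              = intact (leaf ks)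
  ... | just (ks₁ , k , ks₂) = split (leaf ks₁) k (leaf ks₂)

  splitNode : Tree Key × List (Key × Tree Key) → Outcome
  splitNode (c , f) with splitMedian f
  ... | nothing                  = intact (node c f)
  ... | just (f₁ , (k , d) , f₂) = split (node c f₁) k (node d f₂)

  absorb : Outcome → List (Key × Tree Key) → Tree Key × List (Key × Tree Key)
  absorb (intact c)    f = c , f
  absorb (split c k d) f = c , (k , d) ∷ f

  insertKey : Key → List Key → List Key
  insertKey x []       = x ∷ []
  insertKey x (k ∷ ks) = if does (x <ₖ? k) then x ∷ k ∷ ks else k ∷ insertKey x ks

  mutual
    insertBelow : Key → Tree Key → Outcome
    insertBelow x (leaf ks)  = splitLeaf (insertKey x ks)
    insertBelow x (node c f) = splitNode (insertBelow* x c f)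

    insertBelow* : Key → Tree Key → List (Key × Tree Key) →
                   Tree Key × List (Key × Tree Key)
    insertBelow* x c []            = absorb (insertBelow x c) []
    insertBelow* x c ((k , d) ∷ f) with x <ₖ? k
    ... | yes _ = absorb (insertBelow x c) ((k , d) ∷ f)
    ... | no  _ = let (d′ , f′) = insertBelow* x d f in c , (k , d′) ∷ f′

  insert : Key → Tree Key → Tree Key
  insert x t with insertBelow x t
  ... | intact t′   = t′
  ... | split c k d = node c ((k , d) ∷ [])

  -- The leaf, counted from left to right, in which a new key is placed.
  mutual
    leafOf : Key → (t : Tree Key) → Fin (leaves t)
    leafOf x (leaf _)   = zero
    leafOf x (node c f) = leafOf* x c f

    leafOf* : Key → (c : Tree Key) (f : List (Key × Tree Key)) → Fin (leaves* c f)
    leafOf* x c []            = leafOf x c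
    leafOf* x c ((k , d) ∷ f) with x <ₖ? k
    ... | yes _ = leafOf x c ↑ˡ leaves* d f
    ... | no  _ = leaves c ↑ʳ leafOf* x d f

  _⟶[_]_ : (T : BTree) → Fin (leaves (tree T)) → BTree → Set (c ⊔ ℓ₁)
  T ⟶[ i ] T′ = ∃[ x ] All (λ k → ¬ x ≈ₖ k) (keys (tree T)) ×
                        leafOf x (tree T) ≡ i × tree T′ ≡ insert x (tree T)

  ----------------------------------------------------------------------
  -- Histories

  HasOneKey : BTree → Set c
  HasOneKey T = ∃[ x ] tree T ≡ leaf (x ∷ [])

  -- Sequences (T₁ , … , Tₙ) are stored with the latest tree first.
  data IsHistory : ∀ {n} → Vec BTree n → Set (c ⊔ ℓ₁ ⊔ ℓ₂) where
    start : ∀ {T} → HasOneKey T → IsHistory (T ∷ [])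
    step  : ∀ {n T T′ i} {Ts : Vec BTree n} →
            IsHistory (T ∷ Ts) → T ⟶[ i ] T′ → IsHistory (T′ ∷ T ∷ Ts)

  History : ℕ → Set (c ⊔ ℓ₁ ⊔ ℓ₂)
  History n = Σ[ Ts ∈ Vec BTree n ] IsHistory Ts

  -- Two histories are equal when their trees are pairwise isomorphic.
  historySetoid : ℕ → Setoid (c ⊔ ℓ₁ ⊔ ℓ₂) 0ℓ
  historySetoid n = On.setoid {B = History n} (≡.setoid (Vec (Tree ⊤) n))
    (λ (Ts , _) → Vec.map (λ T → shape (tree T)) Ts)

------------------------------------------------------------------------
-- Historic trees

module HistoricTrees (m : ℕ) where

  Branching : ℕ → Set
  Branching h = ∃[ j ] h ≡ 2 * m + j * (m + 1)

  branching? : ∀ h → Dec (Branching h)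
  branching? h = map′ to from (2 * m ≤? h ×-dec (m + 1) ∣? (h ∸ 2 * m))
    where
    to : 2 * m ≤ h × (m + 1) ∣ (h ∸ 2 * m) → Branching h
    to (2m≤h , divides j eq) =
      j , trans (sym (m+[n∸m]≡n 2m≤h)) (cong (2 * m +_) eq)

    from : Branching h → 2 * m ≤ h × (m + 1) ∣ (h ∸ 2 * m)
    from (j , refl) =
      m≤m+n (2 * m) _ , divides j (m+n∸m≡n (2 * m) _)

  slots : ℕ → ℕ
  slots h = if does (branching? h) then 2 else 1

  -- `Slot h` is a slot at height h together with everything below it: either
  -- unoccupied (an external vertex) or occupied by a labelled vertex with its
  -- child slots. A plane tree as a whole occupies a slot at height 0.
  data Slot (h : ℕ) : Set where
    external : Slot h
    vertex   : ℕ → Vec (Slot (suc h)) (slots h) → Slot h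

  mutual
    labels : ∀ {h} → Slot h → List ℕ
    labels external      = []
    labels (vertex l ss) = l ∷ labels* ss

    labels* : ∀ {h n} → Vec (Slot h) n → List ℕ
    labels* []       = []
    labels* (s ∷ ss) = labels s ++ labels* ss

  data LabelAbove {h} (l : ℕ) : Slot h → Set where
    external : LabelAbove l external
    vertex   : ∀ {l′ ss} → l < l′ → LabelAbove l (vertex l′ ss)

  data Increasing {h} : Slot h → Set where
    external : Increasing external
    vertex   : ∀ {l ss} → VecAll (LabelAbove l) ss → VecAll Increasing ss →
               Increasing (vertex l ss)

  record IsHistoric (n : ℕ) (H : Slot 0) : Set where
    field
      labelled   : labels H ↭ applyUpTo suc n
      increasing : Increasing H

  HistoricTree : ℕ → Set
  HistoricTree n = Σ[ H ∈ Slot 0 ] IsHistoric n H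

  historicSetoid : ℕ → Setoid 0ℓ 0ℓ
  historicSetoid n = On.setoid (≡.setoid (Slot 0)) (proj₁ {B = IsHistoric n})

  mutual
    externals : ∀ {h} → Slot h → ℕ
    externals external      = 1
    externals (vertex _ ss) = externals* ss

    externals* : ∀ {h n} → Vec (Slot h) n → ℕ
    externals* []       = 0
    externals* (s ∷ ss) = externals s + externals* ss

  mutual
    -- Put a new vertex with the given label at an external vertex.
    place : ∀ {h} → ℕ → (s : Slot h) → Fin (externals s) → Slot h
    place l external      _ = vertex l (Vec.replicate _ external)
    place l (vertex k ss) i = vertex k (place* l ss i)

    place* : ∀ {h n} → ℕ → (ss : Vec (Slot h) n) → Fin (externals* ss) → Vec (Slot h) n
    place* l (s ∷ ss) i with splitAt (externals s) i
    ... | inj₁ j = place l s j ∷ ss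
    ... | inj₂ j = s ∷ place* l ss j

------------------------------------------------------------------------
-- The recursion defining Φ, as a relation between sequences and trees

module Correspondence {c ℓ₁ ℓ₂} (K : KeyOrder c ℓ₁ ℓ₂) (m : ℕ) where

  open BTrees K m public
  open HistoricTrees m public

  data Φ[_]=_ : ∀ {n} → Vec BTree n → Slot 0 → Set (c ⊔ ℓ₁ ⊔ ℓ₂) where
    start : ∀ {T} → HasOneKey T →
            Φ[ T ∷ [] ]= vertex 1 (Vec.replicate _ external)
    step  : ∀ {k T T′ H i} {Ts : Vec BTree k} {j : Fin (externals H)} →
            Φ[ T ∷ Ts ]= H → T ⟶[ i ] T′ → toℕ i ≡ toℕ j →
            Φ[ T′ ∷ T ∷ Ts ]= place (suc (suc k)) H j

{-# OPTIONS --safe #-}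
module Submission where

-- Read from left to right, the numbers of keys in the leaves of Tₖ and the
-- heights of the external vertices of Hₖ evolve in parallel: an insertion
-- replaces a leaf with s < 2m keys by one with s + 1 keys and a leaf with 2m
-- keys by two with m keys, and a placement replaces a height h by one or two
-- copies of h + 1 according to whether h is a branching.  Branchings are
-- exactly the heights that correspond to full leaves, so the numbers of leaves
-- and external vertices agree.  Neither replacement keeps the entry it acts on
-- in place, so the position is determined by the leaf sizes before and after
-- the insertion; hence Φ is a function of the shapes.  Conversely, removing
-- the largest label from a historic tree recovers the previous one together
-- with the position of the insertion, the shape after an insertion depends
-- only on the previous shape and that position, and by density every leaf
-- can receive a new key.

open import Data.Bool.Base using (true; false; T)
open import Data.Fin.Base using (Fin; zero; suc; toℕ; splitAt; _↑ˡ_; _↑ʳ_; cast)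
open import Data.Fin.Properties
  using (toℕ-↑ˡ; toℕ-↑ʳ; toℕ<n; toℕ-cast; toℕ-injective;
         splitAt-↑ˡ; splitAt-↑ʳ; splitAt⁻¹-↑ˡ; splitAt⁻¹-↑ʳ)
open import Data.List.Base as List using (List; []; _∷_; [_]; _++_; length; take; drop; applyUpTo)
import Data.List.Properties as List
open import Data.List.Relation.Binary.Pointwise as Pointwise using (Pointwise; []; _∷_)
open import Data.List.Relation.Unary.All as All using (All; []; _∷_)
import Data.List.Relation.Unary.All.Properties as All
open import Data.List.Relation.Unary.AllPairs using (AllPairs; []; _∷_)
import Data.List.Relation.Unary.AllPairs.Properties as AllPairs
open import Data.List.Membership.Propositional using (_∈_)
open import Data.List.Membership.Propositional.Properties using (∈-++⁻)
open import Data.List.Relation.Binary.Permutation.Propositional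
  using (_↭_; prep; swap; ↭-refl; ↭-reflexive; ↭-sym; ↭-trans)
import Data.List.Relation.Binary.Permutation.Propositional.Properties as ↭
open import Data.List.Relation.Unary.Any using (here; there)
open import Data.Maybe.Base as Maybe using (Maybe; just; nothing)
open import Data.Nat.Base using (ℕ; zero; suc; _+_; _*_; _∸_; _≤_; _<_; z≤n; s≤s; s≤s⁻¹; _≤ᵇ_)
open import Data.Nat.Properties
open import Data.Product.Base using (Σ-syntax; ∃-syntax; ∃; _×_; _,_; proj₁; proj₂)
open import Data.Nat.Solver using (module +-*-Solver)
open import Data.Sum.Base as Sum using (_⊎_; inj₁; inj₂)
open import Data.Unit.Base using (⊤; tt)
open import Data.Vec.Base as Vec using (Vec; []; _∷_)
open import Data.Vec.Relation.Unary.All using ([]; _∷_) renaming (All to VecAll)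
import Data.Vec.Properties as Vec
open import Function.Base using (_∘_; const)
open import Function.Bundles using (Bijection; _⇔_; mk⇔)
open import Level using (Level; _⊔_)
open import Relation.Binary.Bundles using (StrictTotalOrder; DenseLinearOrder)
open import Relation.Binary.Core using (REL)
open import Relation.Binary.Definitions using (tri<; tri≈; tri>)
open import Relation.Binary.PropositionalEquality
  using (_≡_; _≢_; refl; sym; trans; cong; cong₂; subst; subst₂; module ≡-Reasoning)
open import Relation.Nullary using (¬_; yes; no; contradiction)
open import Relation.Nullary.Decidable using (dec-true; dec-false)
open import Defs

private
  variable
    a b r : Level
    A : Set a
    B : Set b

-- Replacing one entry of a list by several.

expandAt : (A → List A) → ℕ → List A → List A
expandAt f _       []       = []
expandAt f zero    (x ∷ xs) = f x ++ xs
expandAt f (suc i) (x ∷ xs) = x ∷ expandAt f i xs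

expandAt-++ˡ : (f : A → List A) {i : ℕ} (xs ys : List A) → i < length xs →
               expandAt f i (xs ++ ys) ≡ expandAt f i xs ++ ys
expandAt-++ˡ f {zero}  (x ∷ xs) ys _         = sym (List.++-assoc (f x) xs ys)
expandAt-++ˡ f {suc i} (x ∷ xs) ys (s≤s i<n) = cong (x ∷_) (expandAt-++ˡ f xs ys i<n)

expandAt-++ʳ : (f : A → List A) {i : ℕ} (xs ys : List A) →
               expandAt f (length xs + i) (xs ++ ys) ≡ xs ++ expandAt f i ys
expandAt-++ʳ f []       ys = refl
expandAt-++ʳ f (x ∷ xs) ys = cong (x ∷_) (expandAt-++ʳ f xs ys)

-- By `f≢` a replacement never leaves the old entry in front, so the replaced position is the first
-- one at which the result departs from `xs`.
expandAt-injective : (f : A → List A) → (∀ x ys zs → f x ++ ys ≢ x ∷ zs) →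
                     ∀ {i j} xs → i < length xs → j < length xs →
                     expandAt f i xs ≡ expandAt f j xs → i ≡ j
expandAt-injective f f≢ {zero}  {zero}  (x ∷ xs) _ _ eq = refl
expandAt-injective f f≢ {zero}  {suc j} (x ∷ xs) _ _ eq = contradiction eq (f≢ x _ _)
expandAt-injective f f≢ {suc i} {zero}  (x ∷ xs) _ _ eq = contradiction (sym eq) (f≢ x _ _)
expandAt-injective f f≢ {suc i} {suc j} (x ∷ xs) (s≤s i<n) (s≤s j<n) eq =
  cong suc (expandAt-injective f f≢ xs i<n j<n (List.∷-injectiveʳ eq))

expandAt-pointwise : {R : REL A B r} {f : A → List A} {g : B → List B} →
                     (∀ {x y} → R x y → Pointwise R (f x) (g y)) →
                     ∀ i {xs ys} → Pointwise R xs ys →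
                     Pointwise R (expandAt f i xs) (expandAt g i ys)
expandAt-pointwise f~g i       []           = []
expandAt-pointwise f~g zero    (x~y ∷ x~ys) = Pointwise.++⁺ (f~g x~y) x~ys
expandAt-pointwise f~g (suc i) (x~y ∷ x~ys) = x~y ∷ expandAt-pointwise f~g i x~ys

map-const : {x : B} (xs ys : List A) → length xs ≡ length ys →
            List.map (const x) xs ≡ List.map (const x) ys
map-const []       []       _  = refl
map-const (_ ∷ xs) (_ ∷ ys) eq = cong (_ ∷_) (map-const xs ys (suc-injective eq))

-- Forests and their keys, leaf sizes and shapes.

-- A tree that has to be split by a parent is described, like the contents of
-- a node, as a first tree with the separating keys and trees to its right.
Forest : Set a → Set a
Forest A = Tree A × List (A × Tree A)

-- Without a separator nothing was split at the top and the tree itself remains; otherwise a new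
-- root joins the parts.
root : Forest A → Tree A
root (t , [])        = t
root (c , f@(_ ∷ _)) = node c f

shapeF : Forest A → Forest ⊤
shapeF (c , f) = shape c , shape* f

mutual
  leafSizes : Tree A → List ℕ
  leafSizes (leaf ks)  = length ks ∷ []
  leafSizes (node c f) = leafSizes c ++ leafSizes* f

  leafSizes* : List (A × Tree A) → List ℕ
  leafSizes* []            = []
  leafSizes* ((_ , d) ∷ f) = leafSizes d ++ leafSizes* f

keysF : Forest A → List A
keysF (c , f) = keys c ++ keys* f

leafSizesF : Forest A → List ℕ
leafSizesF (c , f) = leafSizes c ++ leafSizes* f

keys-root : (F : Forest A) → keys (root F) ≡ keysF F
keys-root (t , [])    = sym (List.++-identityʳ (keys t))
keys-root (t , _ ∷ _) = refl

leafSizes-root : (F : Forest A) → leafSizes (root F) ≡ leafSizesF F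
leafSizes-root (t , [])    = sym (List.++-identityʳ (leafSizes t))
leafSizes-root (t , _ ∷ _) = refl

shape-root : (F : Forest A) → shape (root F) ≡ root (shapeF F)
shape-root (t , [])    = refl
shape-root (t , _ ∷ _) = refl

keys*-++ : (f g : List (A × Tree A)) → keys* (f ++ g) ≡ keys* f ++ keys* g
keys*-++ []            g = refl
keys*-++ ((k , d) ∷ f) g = cong (k ∷_) (trans
  (cong (keys d ++_) (keys*-++ f g)) (sym (List.++-assoc (keys d) (keys* f) (keys* g))))

leafSizes*-++ : (f g : List (A × Tree A)) → leafSizes* (f ++ g) ≡ leafSizes* f ++ leafSizes* g
leafSizes*-++ []            g = refl
leafSizes*-++ ((k , d) ∷ f) g = trans
  (cong (leafSizes d ++_) (leafSizes*-++ f g))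
  (sym (List.++-assoc (leafSizes d) (leafSizes* f) (leafSizes* g)))

shape*-map : (f : List (A × Tree A)) → shape* f ≡ List.map (λ (_ , d) → tt , shape d) f
shape*-map []            = refl
shape*-map ((_ , d) ∷ f) = cong (_ ∷_) (shape*-map f)

mutual
  length-leafSizes : (t : Tree A) → length (leafSizes t) ≡ leaves t
  length-leafSizes (leaf ks)  = refl
  length-leafSizes (node c f) = length-leafSizesF c f

  length-leafSizesF : (c : Tree A) (f : List (A × Tree A)) →
                      length (leafSizesF (c , f)) ≡ leaves* c f
  length-leafSizesF c []            = trans
    (cong length (List.++-identityʳ (leafSizes c))) (length-leafSizes c)
  length-leafSizesF c ((_ , d) ∷ f) = trans (List.length-++ (leafSizes c))
    (cong₂ _+_ (length-leafSizes c) (length-leafSizesF d f))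

mutual
  leaves-shape : (t : Tree A) → leaves (shape t) ≡ leaves t
  leaves-shape (leaf ks)  = refl
  leaves-shape (node c f) = leaves*-shape c f

  leaves*-shape : (c : Tree A) (f : List (A × Tree A)) →
                  leaves* (shape c) (shape* f) ≡ leaves* c f
  leaves*-shape c []            = leaves-shape c
  leaves*-shape c ((_ , d) ∷ f) = cong₂ _+_ (leaves-shape c) (leaves*-shape d f)

mutual
  leafSizes-shape : (t : Tree A) → leafSizes (shape t) ≡ leafSizes t
  leafSizes-shape (leaf ks)  = cong [_] (List.length-map _ ks)
  leafSizes-shape (node c f) = cong₂ _++_ (leafSizes-shape c) (leafSizes*-shape f)

  leafSizes*-shape : (f : List (A × Tree A)) → leafSizes* (shape* f) ≡ leafSizes* f
  leafSizes*-shape []            = refl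
  leafSizes*-shape ((_ , d) ∷ f) = cong₂ _++_ (leafSizes-shape d) (leafSizes*-shape f)

-- Splitting at the median.

module Insertion {c ℓ₁ ℓ₂} (K : KeyOrder c ℓ₁ ℓ₂) (m : ℕ) where

  open Correspondence K m

  -- The case distinction used to reason about `splitMedian`. The second half has only a lower bound
  -- here; the upper bound for at most 2m + 1 entries is `length-secondHalf`.
  data Median {A : Set a} : List A → Maybe (List A × A × List A) → Set a where
    whole : ∀ {xs} → length xs ≤ 2 * m → Median xs nothing
    parts : ∀ {xs y zs} → length xs ≡ m → m ≤ length zs →
            Median (xs ++ y ∷ zs) (just (xs , y , zs))

  median : (xs : List A) → Median xs (splitMedian xs)
  -- The test `does (length xs ≤? 2 * m)` in `splitMedian` computes to this Boolean.
  median xs with length xs ≤ᵇ 2 * m in le | drop m xs in eq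
  ... | true  | _      = whole (≤ᵇ⇒≤ _ _ (subst T (sym le) tt))
  -- Nothing left after m entries means at most m, hence at most 2m entries, against the failed
  -- test.
  ... | false | []     = contradiction
    (≤-trans (m∸n≡0⇒m≤n (trans (sym (List.length-drop m xs)) (cong length eq))) (m≤m+n m _))
    (λ small → subst T le (≤⇒≤ᵇ small))
  ... | false | y ∷ ys = subst (λ zs → Median zs (just (take m xs , y , ys)))
    (trans (cong (take m xs ++_) (sym eq)) (List.take++drop≡id m xs))
    (parts (trans (List.length-take m xs) (m≤n⇒m⊓n≡m m≤xs)) m≤ys)
    where
    large : 2 * m < length xs
    large = ≰⇒> (λ small → subst T le (≤⇒≤ᵇ small))

    m≤xs : m ≤ length xs
    m≤xs = ≤-trans (m≤m+n m _) (<⇒≤ large)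

    m≤ys : m ≤ length ys
    m≤ys = s≤s⁻¹ (+-cancelˡ-≤ m _ _ (begin
      m + suc m             ≡⟨ +-suc m m ⟩
      suc (m + m)           ≡⟨ cong (λ n → suc (m + n)) (+-identityʳ m) ⟨
      suc (2 * m)           ≤⟨ large ⟩
      length xs             ≡⟨ m+[n∸m]≡n m≤xs ⟨
      m + (length xs ∸ m)   ≡⟨ cong (m +_) (List.length-drop m xs) ⟨
      m + length (drop m xs) ≡⟨ cong (λ zs → m + length zs) eq ⟩
      m + suc (length ys)   ∎))
      where open ≤-Reasoning

  -- Where a list is cut depends on its length alone, so erasing keys commutes with splitting.
  splitMedian-map : (g : A → B) (xs : List A) →
                    splitMedian (List.map g xs) ≡
                    Maybe.map (λ (ys , y , zs) → List.map g ys , g y , List.map g zs) (splitMedian xs)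
  splitMedian-map g xs rewrite List.length-map g xs | List.drop-map {f = g} m xs
    with length xs ≤ᵇ 2 * m | drop m xs
  ... | true  | _      = refl
  ... | false | []     = refl
  ... | false | y ∷ ys = cong (λ zs → just (zs , g y , List.map g ys)) (List.take-map m xs)

  -- Splitting for arbitrary entries, so that it applies to shapes, whose keys are erased, as well
  -- as to trees with keys.
  splitLeafF : List A → Forest A
  splitLeafF ks with splitMedian ks
  ... | nothing              = leaf ks , []
  ... | just (ks₁ , k , ks₂) = leaf ks₁ , (k , leaf ks₂) ∷ []

  splitNodeF : Forest A → Forest A
  splitNodeF (c , f) with splitMedian f
  ... | nothing                  = node c f , []
  ... | just (f₁ , (k , d) , f₂) = node c f₁ , (k , node d f₂) ∷ []

  forest : Outcome → Forest Key
  forest (intact t)    = t , []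
  forest (split c k d) = c , (k , d) ∷ []

  forest-splitLeaf : (ks : List Key) → forest (splitLeaf ks) ≡ splitLeafF ks
  forest-splitLeaf ks with splitMedian ks
  ... | nothing = refl
  ... | just _  = refl

  forest-splitNode : (F : Forest Key) → forest (splitNode F) ≡ splitNodeF F
  forest-splitNode (c , f) with splitMedian f
  ... | nothing = refl
  ... | just _  = refl

  insert-root : (x : Key) (t : Tree Key) → insert x t ≡ root (forest (insertBelow x t))
  insert-root x t with insertBelow x t
  ... | intact _    = refl
  ... | split _ _ _ = refl

  -- The key that moves up stays at its in-order position between the two halves.
  keysF-splitNodeF : (F : Forest A) → keysF (splitNodeF F) ≡ keysF F
  keysF-splitNodeF (c , f) with splitMedian f | median f
  ... | nothing | _ = List.++-identityʳ _
  ... | just (f₁ , (k , d) , f₂) | parts _ _ = begin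
    (keys c ++ keys* f₁) ++ k ∷ (keys d ++ keys* f₂) ++ [] ≡⟨ List.++-assoc (keys c) _ _ ⟩
    keys c ++ keys* f₁ ++ k ∷ (keys d ++ keys* f₂) ++ []
      ≡⟨ cong (λ ks → keys c ++ keys* f₁ ++ k ∷ ks) (List.++-identityʳ _) ⟩
    keys c ++ keys* f₁ ++ k ∷ keys d ++ keys* f₂           ≡⟨ cong (keys c ++_) (keys*-++ f₁ _) ⟨
    keys c ++ keys* (f₁ ++ (k , d) ∷ f₂)                   ∎
    where open ≡-Reasoning

  -- A split above the leaves regroups whole subtrees; only the split of a leaf affects leaf sizes.
  leafSizesF-splitNodeF : (F : Forest A) → leafSizesF (splitNodeF F) ≡ leafSizesF F
  leafSizesF-splitNodeF (c , f) with splitMedian f | median f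
  ... | nothing | _ = List.++-identityʳ _
  ... | just (f₁ , (k , d) , f₂) | parts _ _ = begin
    (leafSizes c ++ leafSizes* f₁) ++ (leafSizes d ++ leafSizes* f₂) ++ []
      ≡⟨ List.++-assoc (leafSizes c) _ _ ⟩
    leafSizes c ++ leafSizes* f₁ ++ (leafSizes d ++ leafSizes* f₂) ++ []
      ≡⟨ cong (λ ks → leafSizes c ++ leafSizes* f₁ ++ ks) (List.++-identityʳ _) ⟩
    leafSizes c ++ leafSizes* f₁ ++ leafSizes d ++ leafSizes* f₂
      ≡⟨ cong (leafSizes c ++_) (leafSizes*-++ f₁ _) ⟨
    leafSizes c ++ leafSizes* (f₁ ++ (k , d) ∷ f₂) ∎
    where open ≡-Reasoning

  shapeF-splitLeafF : (ks : List A) → shapeF (splitLeafF ks) ≡ splitLeafF (List.map (const tt) ks)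
  shapeF-splitLeafF ks rewrite splitMedian-map (const tt) ks with splitMedian ks
  ... | nothing = refl
  ... | just _  = refl

  shapeF-splitNodeF : (F : Forest A) → shapeF (splitNodeF F) ≡ splitNodeF (shapeF F)
  shapeF-splitNodeF (c , f)
    rewrite shape*-map f | splitMedian-map (λ (_ , d) → tt , shape d) f with splitMedian f
  ... | nothing = cong (λ g → node (shape c) g , []) (shape*-map f)
  ... | just (f₁ , (_ , d) , f₂) =
    cong₂ (λ g₁ g₂ → node (shape c) g₁ , (tt , node (shape d) g₂) ∷ []) (shape*-map f₁) (shape*-map f₂)

  keysF-splitLeafF : (ks : List A) → keysF (splitLeafF ks) ≡ ks
  keysF-splitLeafF ks with splitMedian ks | median ks
  ... | nothing              | _         = List.++-identityʳ ks
  ... | just (ks₁ , k , ks₂) | parts _ _ = cong (λ ys → ks₁ ++ k ∷ ys) (List.++-identityʳ ks₂)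

  -- The effect of an insertion on a leaf with s keys. Writing the right half as `s ∸ m` makes this
  -- correct for every s; for a full leaf, s = 2m, it is m.
  bump : ℕ → List ℕ
  bump s with suc s ≤? 2 * m
  ... | yes _ = suc s ∷ []
  ... | no  _ = m ∷ s ∸ m ∷ []

  leafSizesF-splitLeafF : (ks : List A) {s : ℕ} → length ks ≡ suc s →
                          leafSizesF (splitLeafF ks) ≡ bump s
  leafSizesF-splitLeafF ks {s} eq with splitMedian ks | median ks | suc s ≤? 2 * m
  ... | nothing | _          | yes _    = cong [_] eq
  ... | nothing | whole small | no large = contradiction (subst (_≤ 2 * m) eq small) large
  -- Two parts of at least m keys and the median are more than 2m keys.
  ... | just (ks₁ , k , ks₂) | parts l₁ l₂ | yes small =
    contradiction (≤-<-trans (+-mono-≤ (≤-reflexive (sym l₁)) (≤-trans (≤-reflexive (+-identityʳ m)) l₂))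
      (≤-trans (≤-reflexive (sym (trans (List.length-++ ks₁) (+-suc _ _)))) (subst (_≤ 2 * m) (sym eq) small)))
      (<-irrefl refl)
  ... | just (ks₁ , k , ks₂) | parts l₁ l₂ | no _ = cong₂ (λ i j → i ∷ j ∷ []) l₁ (begin
    length ks₂                        ≡⟨ m+n∸m≡n m (length ks₂) ⟨
    m + length ks₂ ∸ m                ≡⟨ cong (λ i → i + length ks₂ ∸ m) l₁ ⟨
    length ks₁ + length ks₂ ∸ m       ≡⟨ cong (_∸ m) (suc-injective
      (trans (sym (+-suc _ _)) (trans (sym (List.length-++ ks₁)) eq))) ⟩
    s ∸ m                             ∎)
    where open ≡-Reasoning

  -- Inserting into a list of keys.

  length-insertKey : ∀ x ks → length (insertKey x ks) ≡ suc (length ks)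
  length-insertKey x []       = refl
  length-insertKey x (k ∷ ks) with x <ₖ? k
  ... | yes _ = refl
  ... | no  _ = cong suc (length-insertKey x ks)

  -- The new key stops just before `k` at the latest, so it never reaches `ls`.
  insertKey-++ˡ : ∀ {x k} ks {ls} → x <ₖ k → insertKey x (ks ++ k ∷ ls) ≡ insertKey x ks ++ k ∷ ls
  insertKey-++ˡ {x} {k} [] x<k with x <ₖ? k
  ... | yes _  = refl
  ... | no x≮k = contradiction x<k x≮k
  insertKey-++ˡ {x} (k ∷ ks) x<l with x <ₖ? k
  ... | yes _ = refl
  ... | no  _ = cong (k ∷_) (insertKey-++ˡ ks x<l)

  insertKey-++ʳ : ∀ {x ks ls} → All (λ k → ¬ x <ₖ k) ks → insertKey x (ks ++ ls) ≡ ks ++ insertKey x ls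
  insertKey-++ʳ         []                     = refl
  insertKey-++ʳ {x = x} (_∷_ {k} x≮k x≮ks) with x <ₖ? k
  ... | yes x<k = contradiction x<k x≮k
  ... | no  _   = cong (k ∷_) (insertKey-++ʳ x≮ks)

  -- Appends the siblings to the right of a child to the outcome of an insertion into it; `absorb`
  -- has this form.
  _++F_ : Forest A → List (A × Tree A) → Forest A
  (c , f) ++F g = c , f ++ g

  ++F-identityʳ : (F : Forest A) → F ++F [] ≡ F
  ++F-identityʳ (c , f) = cong (c ,_) (List.++-identityʳ f)

  keysF-++F : (F : Forest A) (g : List (A × Tree A)) → keysF (F ++F g) ≡ keysF F ++ keys* g
  keysF-++F (c , f) g = trans (cong (keys c ++_) (keys*-++ f g)) (sym (List.++-assoc (keys c) _ _))

  leafSizesF-++F : (F : Forest A) (g : List (A × Tree A)) →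
                   leafSizesF (F ++F g) ≡ leafSizesF F ++ leafSizes* g
  leafSizesF-++F (c , f) g =
    trans (cong (leafSizes c ++_) (leafSizes*-++ f g)) (sym (List.++-assoc (leafSizes c) _ _))

  shapeF-++F : (F : Forest A) (g : List (A × Tree A)) → shapeF (F ++F g) ≡ shapeF F ++F shape* g
  shapeF-++F (c , [])          g = refl
  shapeF-++F (c , (_ , d) ∷ f) g = cong (λ (_ , h) → shape c , (tt , shape d) ∷ h) (shapeF-++F (c , f) g)

  absorb-++F : ∀ o f → absorb o f ≡ forest o ++F f
  absorb-++F (intact _)    f = refl
  absorb-++F (split _ _ _) f = refl

  open StrictTotalOrder (KeyOrder.strictTotalOrder K)
    using (compare; <-resp-≈) renaming (trans to <-transₖ; irrefl to <-irreflₖ)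
  module Eqₖ = StrictTotalOrder.Eq (KeyOrder.strictTotalOrder K)

  ≮∧≉⇒>ₖ : ∀ {x k} → ¬ x <ₖ k → ¬ x ≈ₖ k → k <ₖ x
  ≮∧≉⇒>ₖ {x} {k} x≮k x≉k with compare x k
  ... | tri< x<k _ _ = contradiction x<k x≮k
  ... | tri≈ _ x≈k _ = contradiction x≈k x≉k
  ... | tri> _ _ k<x = k<x

  -- Transitivity through k ≤ x, in the negated form that the test `x <ₖ? k` delivers.
  <∧≮⇒<ₖ : ∀ {x k l} → l <ₖ k → ¬ x <ₖ k → l <ₖ x
  <∧≮⇒<ₖ {x} {k} {l} l<k x≮k with compare l x
  ... | tri< l<x _ _ = l<x
  ... | tri≈ _ l≈x _ = contradiction (proj₂ <-resp-≈ l≈x l<k) x≮k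
  ... | tri> _ _ x<l = contradiction (<-transₖ x<l l<k) x≮k

  <⇒≯ₖ : ∀ {x k} → x <ₖ k → ¬ k <ₖ x
  <⇒≯ₖ x<k k<x = <-irreflₖ Eqₖ.refl (<-transₖ x<k k<x)

  AllPairs-insertKey : ∀ {x ks} → All (λ k → ¬ x ≈ₖ k) ks →
                       AllPairs _<ₖ_ ks → AllPairs _<ₖ_ (insertKey x ks)
  AllPairs-insertKey []            []              = [] ∷ []
  AllPairs-insertKey {x} (_∷_ {k} {ks} x≉k x≉ks) (k<ks ∷ <ks) with x <ₖ? k
  ... | yes x<k = (x<k ∷ All.map (<-transₖ x<k) k<ks) ∷ k<ks ∷ <ks
  ... | no  x≮k = below k<ks ∷ AllPairs-insertKey x≉ks <ks
    where
    below : ∀ {ls} → All (k <ₖ_) ls → All (k <ₖ_) (insertKey x ls)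
    below []                  = ≮∧≉⇒>ₖ x≮k x≉k ∷ []
    below (_∷_ {l} k<l k<ls) with x <ₖ? l
    ... | yes _ = ≮∧≉⇒>ₖ x≮k x≉k ∷ k<l ∷ k<ls
    ... | no  _ = k<l ∷ below k<ls

  -- In-order keys and leaf sizes after an insertion.

  mutual
    -- Choosing a child by its separators agrees with walking past smaller keys in the in-order
    -- list. This reduces the order of the new tree to sortedness of a list.
    keysF-insertBelow : ∀ x t → Ordered t → keysF (forest (insertBelow x t)) ≡ insertKey x (keys t)
    keysF-insertBelow x (leaf ks)  _        =
      trans (cong keysF (forest-splitLeaf (insertKey x ks))) (keysF-splitLeafF (insertKey x ks))
    keysF-insertBelow x (node c f) (_ , cf) = trans
      (cong keysF (forest-splitNode (insertBelow* x c f)))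
      (trans (keysF-splitNodeF (insertBelow* x c f)) (keysF-insertBelow* x c f cf))

    keysF-insertBelow* : ∀ x c f → Ordered* c f → keysF (insertBelow* x c f) ≡ insertKey x (keysF (c , f))
    keysF-insertBelow* x c [] oc = begin
      keysF (absorb (insertBelow x c) [])    ≡⟨ cong keysF (absorb-++F (insertBelow x c) []) ⟩
      keysF (forest (insertBelow x c) ++F []) ≡⟨ cong keysF (++F-identityʳ (forest (insertBelow x c))) ⟩
      keysF (forest (insertBelow x c))       ≡⟨ keysF-insertBelow x c oc ⟩
      insertKey x (keys c)                   ≡⟨ cong (insertKey x) (List.++-identityʳ (keys c)) ⟨
      insertKey x (keys c ++ [])             ∎
      where open ≡-Reasoning
    keysF-insertBelow* x c ((k , d) ∷ f) (oc , c<k , _ , df) with x <ₖ? k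
    ... | yes x<k = begin
      keysF (absorb (insertBelow x c) g)         ≡⟨ cong keysF (absorb-++F (insertBelow x c) g) ⟩
      keysF (forest (insertBelow x c) ++F g)     ≡⟨ keysF-++F (forest (insertBelow x c)) g ⟩
      keysF (forest (insertBelow x c)) ++ keys* g ≡⟨ cong (_++ keys* g) (keysF-insertBelow x c oc) ⟩
      insertKey x (keys c) ++ keys* g            ≡⟨ insertKey-++ˡ (keys c) x<k ⟨
      insertKey x (keys c ++ keys* g)            ∎
      where open ≡-Reasoning
            g = (k , d) ∷ f
    ... | no x≮k = begin
      keys c ++ k ∷ keysF (insertBelow* x d f)   ≡⟨ cong (λ ks → keys c ++ k ∷ ks) (keysF-insertBelow* x d f df) ⟩
      keys c ++ k ∷ insertKey x (keysF (d , f))  ≡⟨ cong (keys c ++_) (insertKey-++ʳ (x≮k ∷ [])) ⟨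
      keys c ++ insertKey x (k ∷ keysF (d , f))
        -- The keys of `c` lie below `k` and `x` does not, so `insertKey` passes all of them.
        ≡⟨ insertKey-++ʳ (All.map (λ l<k → <⇒≯ₖ (<∧≮⇒<ₖ l<k x≮k)) c<k) ⟨
      insertKey x (keys c ++ k ∷ keysF (d , f))  ∎
      where open ≡-Reasoning

  mutual
    -- `leafOf` makes the same comparisons as `insertBelow`, so it names the one leaf that changes.
    leafSizesF-insertBelow : ∀ x t → leafSizesF (forest (insertBelow x t)) ≡
                                     expandAt bump (toℕ (leafOf x t)) (leafSizes t)
    leafSizesF-insertBelow x (leaf ks)  = begin
      leafSizesF (forest (splitLeaf (insertKey x ks))) ≡⟨ cong leafSizesF (forest-splitLeaf (insertKey x ks)) ⟩
      leafSizesF (splitLeafF (insertKey x ks))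
        ≡⟨ leafSizesF-splitLeafF (insertKey x ks) (length-insertKey x ks) ⟩
      bump (length ks)                                 ≡⟨ List.++-identityʳ _ ⟨
      bump (length ks) ++ []                           ∎
      where open ≡-Reasoning
    leafSizesF-insertBelow x (node c f) = trans
      (cong leafSizesF (forest-splitNode (insertBelow* x c f)))
      (trans (leafSizesF-splitNodeF (insertBelow* x c f)) (leafSizesF-insertBelow* x c f))

    leafSizesF-insertBelow* : ∀ x c f → leafSizesF (insertBelow* x c f) ≡
                                        expandAt bump (toℕ (leafOf* x c f)) (leafSizesF (c , f))
    leafSizesF-insertBelow* x c [] = begin
      leafSizesF (absorb (insertBelow x c) [])     ≡⟨ cong leafSizesF (absorb-++F (insertBelow x c) []) ⟩
      leafSizesF (forest (insertBelow x c) ++F []) ≡⟨ cong leafSizesF (++F-identityʳ (forest (insertBelow x c))) ⟩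
      leafSizesF (forest (insertBelow x c))        ≡⟨ leafSizesF-insertBelow x c ⟩
      expandAt bump i (leafSizes c)                ≡⟨ cong (expandAt bump i) (List.++-identityʳ (leafSizes c)) ⟨
      expandAt bump i (leafSizes c ++ [])          ∎
      where open ≡-Reasoning
            i = toℕ (leafOf x c)
    leafSizesF-insertBelow* x c ((k , d) ∷ f) with x <ₖ? k
    ... | yes x<k = begin
      leafSizesF (absorb (insertBelow x c) g)         ≡⟨ cong leafSizesF (absorb-++F (insertBelow x c) g) ⟩
      leafSizesF (forest (insertBelow x c) ++F g)     ≡⟨ leafSizesF-++F (forest (insertBelow x c)) g ⟩
      leafSizesF (forest (insertBelow x c)) ++ leafSizes* g
        ≡⟨ cong (_++ leafSizes* g) (leafSizesF-insertBelow x c) ⟩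
      expandAt bump i (leafSizes c) ++ leafSizes* g
        ≡⟨ expandAt-++ˡ bump (leafSizes c) (leafSizes* g)
             (subst (i <_) (sym (length-leafSizes c)) (toℕ<n (leafOf x c))) ⟨
      expandAt bump i (leafSizes c ++ leafSizes* g)
        ≡⟨ cong (λ j → expandAt bump j (leafSizesF (c , g))) (toℕ-↑ˡ (leafOf x c) (leaves* d f)) ⟨
      expandAt bump (toℕ (leafOf x c ↑ˡ leaves* d f)) (leafSizesF (c , g)) ∎
      where open ≡-Reasoning
            g = (k , d) ∷ f
            i = toℕ (leafOf x c)
    ... | no x≮k = begin
      leafSizes c ++ leafSizesF (insertBelow* x d f)    ≡⟨ cong (leafSizes c ++_) (leafSizesF-insertBelow* x d f) ⟩
      leafSizes c ++ expandAt bump i (leafSizesF (d , f)) ≡⟨ expandAt-++ʳ bump (leafSizes c) _ ⟨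
      expandAt bump (length (leafSizes c) + i) (leafSizes c ++ leafSizesF (d , f))
        ≡⟨ cong (λ j → expandAt bump j (leafSizes c ++ leafSizesF (d , f)))
             (trans (cong (_+ i) (length-leafSizes c)) (sym (toℕ-↑ʳ (leaves c) (leafOf* x d f)))) ⟩
      expandAt bump (toℕ (leaves c ↑ʳ leafOf* x d f)) (leafSizes c ++ leafSizesF (d , f)) ∎
      where open ≡-Reasoning
            i = toℕ (leafOf* x d f)

  leafSizes-insert : ∀ x t → leafSizes (insert x t) ≡ expandAt bump (toℕ (leafOf x t)) (leafSizes t)
  leafSizes-insert x t = begin
    leafSizes (insert x t)                     ≡⟨ cong leafSizes (insert-root x t) ⟩
    leafSizes (root (forest (insertBelow x t))) ≡⟨ leafSizes-root (forest (insertBelow x t)) ⟩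
    leafSizesF (forest (insertBelow x t))      ≡⟨ leafSizesF-insertBelow x t ⟩
    expandAt bump (toℕ (leafOf x t)) (leafSizes t) ∎
    where open ≡-Reasoning

  -- Insertion on shapes.

  mutual
    -- Insertion steered by the position of a leaf instead of by a key. It exhibits the new shape as
    -- a function of the old shape and that position.
    insertAt : ℕ → Tree ⊤ → Forest ⊤
    insertAt i (leaf ks)  = splitLeafF (tt ∷ ks)
    insertAt i (node c f) = splitNodeF (insertAt* i c f)

    insertAt* : ℕ → Tree ⊤ → List (⊤ × Tree ⊤) → Forest ⊤
    insertAt* i c []            = insertAt i c
    insertAt* i c ((k , d) ∷ f) with i <? leaves c
    ... | yes _ = insertAt i c ++F ((k , d) ∷ f)
    ... | no  _ = let (d′ , f′) = insertAt* (i ∸ leaves c) d f in c , (k , d′) ∷ f′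

  mutual
    shapeF-insertBelow : ∀ x t → shapeF (forest (insertBelow x t)) ≡ insertAt (toℕ (leafOf x t)) (shape t)
    shapeF-insertBelow x (leaf ks)  = begin
      shapeF (forest (splitLeaf (insertKey x ks))) ≡⟨ cong shapeF (forest-splitLeaf (insertKey x ks)) ⟩
      shapeF (splitLeafF (insertKey x ks))         ≡⟨ shapeF-splitLeafF (insertKey x ks) ⟩
      splitLeafF (List.map (const tt) (insertKey x ks))
        -- After erasure only the number of keys counts, so the new one may as well stand first.
        ≡⟨ cong splitLeafF (map-const (insertKey x ks) (x ∷ ks) (length-insertKey x ks)) ⟩
      splitLeafF (tt ∷ List.map (const tt) ks)     ∎
      where open ≡-Reasoning
    shapeF-insertBelow x (node c f) = begin
      shapeF (forest (splitNode F))                ≡⟨ cong shapeF (forest-splitNode F) ⟩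
      shapeF (splitNodeF F)                        ≡⟨ shapeF-splitNodeF F ⟩
      splitNodeF (shapeF F)                        ≡⟨ cong splitNodeF (shapeF-insertBelow* x c f) ⟩
      splitNodeF (insertAt* (toℕ (leafOf* x c f)) (shape c) (shape* f)) ∎
      where open ≡-Reasoning
            F = insertBelow* x c f

    shapeF-insertBelow* : ∀ x c f → shapeF (insertBelow* x c f) ≡
                                    insertAt* (toℕ (leafOf* x c f)) (shape c) (shape* f)
    shapeF-insertBelow* x c [] = trans
      (cong shapeF (trans (absorb-++F (insertBelow x c) []) (++F-identityʳ (forest (insertBelow x c)))))
      (shapeF-insertBelow x c)
    shapeF-insertBelow* x c ((k , d) ∷ f) with x <ₖ? k
    -- The tests `x <ₖ? k` and `i <? leaves c` agree: `↑ˡ` yields positions below the number of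
    -- leaves of the first child, `↑ʳ` positions from that number on. The mixed cases are
    -- contradictory.
    ... | yes _ with toℕ (leafOf x c ↑ˡ leaves* d f) <? leaves (shape c)
    ...   | yes _ = begin
      shapeF (absorb (insertBelow x c) g)      ≡⟨ cong shapeF (absorb-++F (insertBelow x c) g) ⟩
      shapeF (forest (insertBelow x c) ++F g)  ≡⟨ shapeF-++F (forest (insertBelow x c)) g ⟩
      shapeF (forest (insertBelow x c)) ++F shape* g ≡⟨ cong (_++F shape* g) (shapeF-insertBelow x c) ⟩
      insertAt (toℕ (leafOf x c)) (shape c) ++F shape* g
        ≡⟨ cong (λ i → insertAt i (shape c) ++F shape* g) (toℕ-↑ˡ (leafOf x c) (leaves* d f)) ⟨
      insertAt (toℕ (leafOf x c ↑ˡ leaves* d f)) (shape c) ++F shape* g ∎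
      where open ≡-Reasoning
            g = (k , d) ∷ f
    ...   | no i≮ = contradiction
      (subst (_< leaves (shape c)) (sym (toℕ-↑ˡ (leafOf x c) (leaves* d f)))
        (subst (toℕ (leafOf x c) <_) (sym (leaves-shape c)) (toℕ<n (leafOf x c)))) i≮
    shapeF-insertBelow* x c ((k , d) ∷ f) | no _ with toℕ (leaves c ↑ʳ leafOf* x d f) <? leaves (shape c)
    ... | yes i< = contradiction
      (subst (_< leaves c) (toℕ-↑ʳ (leaves c) (leafOf* x d f))
        (subst (toℕ (leaves c ↑ʳ leafOf* x d f) <_) (leaves-shape c) i<))
      (m+n≮m (leaves c) _)
    ... | no  _  = cong (λ (d′ , f′) → shape c , (tt , d′) ∷ f′) (trans
      (shapeF-insertBelow* x d f)
      (cong (λ i → insertAt* i (shape d) (shape* f)) (sym (begin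
        toℕ (leaves c ↑ʳ leafOf* x d f) ∸ leaves (shape c) ≡⟨ cong₂ _∸_ (toℕ-↑ʳ (leaves c) _) (leaves-shape c) ⟩
        leaves c + toℕ (leafOf* x d f) ∸ leaves c         ≡⟨ m+n∸m≡n (leaves c) _ ⟩
        toℕ (leafOf* x d f)                              ∎))))
      where open ≡-Reasoning

  shape-insert : ∀ x t → shape (insert x t) ≡ root (insertAt (toℕ (leafOf x t)) (shape t))
  shape-insert x t = begin
    shape (insert x t)                       ≡⟨ cong shape (insert-root x t) ⟩
    shape (root (forest (insertBelow x t)))  ≡⟨ shape-root (forest (insertBelow x t)) ⟩
    root (shapeF (forest (insertBelow x t))) ≡⟨ cong root (shapeF-insertBelow x t) ⟩
    root (insertAt (toℕ (leafOf x t)) (shape t)) ∎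
    where open ≡-Reasoning

  leafSizes-≅ : (T T′ : BTree) → T ≅ T′ → leafSizes (tree T) ≡ leafSizes (tree T′)
  leafSizes-≅ T T′ T≅T′ = begin
    leafSizes (tree T)          ≡⟨ leafSizes-shape (tree T) ⟨
    leafSizes (shape (tree T))  ≡⟨ cong leafSizes T≅T′ ⟩
    leafSizes (shape (tree T′)) ≡⟨ leafSizes-shape (tree T′) ⟩
    leafSizes (tree T′)         ∎
    where open ≡-Reasoning

  -- Insertion preserves the order of keys.

  mutual
    -- With its converse `AllPairs⇒Ordered`, this turns the order condition into sortedness of the
    -- in-order keys, which is insensitive to splits.
    Ordered⇒AllPairs : ∀ t → Ordered t → AllPairs _<ₖ_ (keys t)
    Ordered⇒AllPairs (leaf ks)  o         = o
    Ordered⇒AllPairs (node c f) (<f , cf) = Ordered*⇒AllPairs c f cf <f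

    Ordered*⇒AllPairs : ∀ c f → Ordered* c f → AllPairs _<ₖ_ (List.map proj₁ f) →
                        AllPairs _<ₖ_ (keysF (c , f))
    Ordered*⇒AllPairs c [] oc _ = subst (AllPairs _<ₖ_) (sym (List.++-identityʳ _)) (Ordered⇒AllPairs c oc)
    Ordered*⇒AllPairs c ((k , d) ∷ f) (oc , c<k , k<d , df) (k<f ∷ <f) =
      AllPairs.++⁺ (Ordered⇒AllPairs c oc) (k<df ∷ Ordered*⇒AllPairs d f df <f)
        (All.map (λ l<k → l<k ∷ All.map (<-transₖ l<k) k<df) c<k)
      where
      -- Each later subtree lies above its left separator, which itself lies above `k`.
      above : ∀ {k d} f → Ordered* d f → All (k <ₖ_) (List.map proj₁ f) → All (k <ₖ_) (keys* f)
      above []             _                   _            = []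
      above ((l , e) ∷ f) (_ , _ , l<e , ef) (k<l ∷ k<f) =
        k<l ∷ All.++⁺ (All.map (<-transₖ k<l) l<e) (above f ef k<f)

      k<df : All (k <ₖ_) (keysF (d , f))
      k<df = All.++⁺ k<d (above f df k<f)

  AllPairs-++⁻ : ∀ {xs ys} → AllPairs _<ₖ_ (xs ++ ys) →
                 AllPairs _<ₖ_ xs × AllPairs _<ₖ_ ys × All (λ x → All (x <ₖ_) ys) xs
  AllPairs-++⁻ {[]}     <ys = [] , <ys , []
  AllPairs-++⁻ {x ∷ xs} (x< ∷ <xsys) =
    let (<xs , <ys , xs<ys) = AllPairs-++⁻ <xsys
        (x<xs , x<ys)       = All.++⁻ xs x<
    in (x<xs ∷ <xs) , <ys , x<ys ∷ xs<ys

  mutual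
    AllPairs⇒Ordered : ∀ t → AllPairs _<ₖ_ (keys t) → Ordered t
    AllPairs⇒Ordered (leaf ks)  <ks = <ks
    AllPairs⇒Ordered (node c f) <cf = separators f (proj₁ (proj₂ (AllPairs-++⁻ <cf))) , AllPairs⇒Ordered* c f <cf
      where
      separators-above : ∀ {k} f → All (k <ₖ_) (keys* f) → All (k <ₖ_) (List.map proj₁ f)
      separators-above []            _           = []
      separators-above ((l , e) ∷ f) (k<l ∷ k<f) = k<l ∷ separators-above f (All.++⁻ʳ (keys e) k<f)

      separators : ∀ f → AllPairs _<ₖ_ (keys* f) → AllPairs _<ₖ_ (List.map proj₁ f)
      separators []            _           = []
      separators ((k , d) ∷ f) (k<f ∷ <df) =
        separators-above f (All.++⁻ʳ (keys d) k<f) ∷ separators f (proj₁ (proj₂ (AllPairs-++⁻ {keys d} <df)))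

    AllPairs⇒Ordered* : ∀ c f → AllPairs _<ₖ_ (keysF (c , f)) → Ordered* c f
    AllPairs⇒Ordered* c []            <c = AllPairs⇒Ordered c (proj₁ (AllPairs-++⁻ <c))
    AllPairs⇒Ordered* c ((k , d) ∷ f) <cf with AllPairs-++⁻ {keys c} <cf
    ... | <c , (k<df ∷ <df) , c<df =
      AllPairs⇒Ordered c <c , All.map All.head c<df , All.++⁻ˡ (keys d) k<df , AllPairs⇒Ordered* d f <df

  keys-insert : ∀ x t → Ordered t → keys (insert x t) ≡ insertKey x (keys t)
  keys-insert x t o = begin
    keys (insert x t)                     ≡⟨ cong keys (insert-root x t) ⟩
    keys (root (forest (insertBelow x t))) ≡⟨ keys-root (forest (insertBelow x t)) ⟩
    keysF (forest (insertBelow x t))      ≡⟨ keysF-insertBelow x t o ⟩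
    insertKey x (keys t)                  ∎
    where open ≡-Reasoning

  Ordered-insert : ∀ {x} t → All (λ k → ¬ x ≈ₖ k) (keys t) → Ordered t → Ordered (insert x t)
  Ordered-insert {x} t x∉t o = AllPairs⇒Ordered (insert x t)
    (subst (AllPairs _<ₖ_) (sym (keys-insert x t o)) (AllPairs-insertKey x∉t (Ordered⇒AllPairs t o)))

  -- Insertion preserves node sizes and equal leaf depth.

  Balanced : ℕ → ℕ → Tree Key → Set c
  Balanced l h t = NodeSizes m l t × LeavesAtDepth h t

  -- The halves of a split are never roots, so they obey the lower bound m whatever `l` was.
  data BalancedOutcome (l h : ℕ) : Outcome → Set c where
    intact : ∀ {t} → Balanced l h t → BalancedOutcome l h (intact t)
    split  : ∀ {c k d} → Balanced m h c → Balanced m h d → BalancedOutcome l h (split c k d)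

  Balanced-node : ∀ {l h c f} → l ≤ length f → length f ≤ 2 * m →
                  Balanced m h c → All (Balanced m h ∘ proj₂) f → Balanced l (suc h) (node c f)
  Balanced-node l≤ ≤2m (sc , hc) bf = let (sf , hf) = All.unzip bf in node l≤ ≤2m sc sf , node hc hf

  -- Of at most 2m + 1 entries, m form the first half and one moves up.
  length-secondHalf : (xs : List A) {y : A} {zs : List A} → length (xs ++ y ∷ zs) ≤ suc (2 * m) →
                length xs ≡ m → length zs ≤ m
  length-secondHalf xs {y} {zs} le l = +-cancelˡ-≤ m _ _ (begin
    m + length zs          ≡⟨ cong (_+ length zs) l ⟨
    length xs + length zs  ≤⟨ s≤s⁻¹ (≤-trans (≤-reflexive (sym (trans (List.length-++ xs) (+-suc _ _)))) le) ⟩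
    2 * m                  ≡⟨ cong (m +_) (+-identityʳ m) ⟩
    m + m                  ∎)
    where open ≤-Reasoning

  m≤2m : m ≤ 2 * m
  m≤2m = m≤m+n m _

  Balanced-splitLeaf : ∀ {l} ks → l ≤ length ks → length ks ≤ suc (2 * m) → BalancedOutcome l 0 (splitLeaf ks)
  Balanced-splitLeaf ks l≤ ≤2m+1 with splitMedian ks | median ks
  ... | nothing              | whole ≤2m = intact (leaf l≤ ≤2m , leaf)
  ... | just (ks₁ , k , ks₂) | parts l₁ l₂ = split
    (leaf (≤-reflexive (sym l₁)) (≤-trans (≤-reflexive l₁) m≤2m) , leaf)
    (leaf l₂ (≤-trans (length-secondHalf ks₁ ≤2m+1 l₁) m≤2m) , leaf)

  Balanced-splitNode : ∀ {l h c} f → l ≤ length f → length f ≤ suc (2 * m) →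
                       Balanced m h c → All (Balanced m h ∘ proj₂) f →
                       BalancedOutcome l (suc h) (splitNode (c , f))
  Balanced-splitNode f l≤ ≤2m+1 bc bf with splitMedian f | median f
  ... | nothing                  | whole ≤2m = intact (Balanced-node l≤ ≤2m bc bf)
  ... | just (f₁ , (k , d) , f₂) | parts l₁ l₂ with All.++⁻ f₁ bf
  ...   | bf₁ , bd ∷ bf₂ = split
    (Balanced-node (≤-reflexive (sym l₁)) (≤-trans (≤-reflexive l₁) m≤2m) bc bf₁)
    (Balanced-node l₂ (≤-trans (length-secondHalf f₁ ≤2m+1 l₁) m≤2m) bd bf₂)

  -- Here `n` counts the separators before the insertion. At most one is added, so a node never
  -- exceeds 2m + 1 keys and one split suffices.
  BalancedChildren : ℕ → ℕ → Forest Key → Set c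
  BalancedChildren n h (c , f) =
    n ≤ length f × length f ≤ suc n × Balanced m h c × All (Balanced m h ∘ proj₂) f

  Balanced-absorb : ∀ {h o f} → BalancedOutcome m h o → All (Balanced m h ∘ proj₂) f →
                    BalancedChildren (length f) h (absorb o f)
  Balanced-absorb (intact bc)   bf = ≤-refl , n≤1+n _ , bc , bf
  Balanced-absorb (split bc bd) bf = n≤1+n _ , ≤-refl , bc , bd ∷ bf

  mutual
    Balanced-insertBelow : ∀ {l h} x t → Balanced l h t → BalancedOutcome l h (insertBelow x t)
    Balanced-insertBelow x (leaf ks) (leaf l≤ ≤2m , leaf) = Balanced-splitLeaf (insertKey x ks)
      (subst (_ ≤_) (sym (length-insertKey x ks)) (m≤n⇒m≤1+n l≤))
      (subst (_≤ suc (2 * m)) (sym (length-insertKey x ks)) (s≤s ≤2m))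
    Balanced-insertBelow x (node c f) (node l≤ ≤2m sc sf , node hc hf) =
      let (n≤ , ≤n , bc , bf) = Balanced-insertBelow* x c f (sc , hc) (All.zip (sf , hf))
      in Balanced-splitNode (proj₂ (insertBelow* x c f)) (≤-trans l≤ n≤) (≤-trans ≤n (s≤s ≤2m)) bc bf

    Balanced-insertBelow* : ∀ {h} x c f → Balanced m h c → All (Balanced m h ∘ proj₂) f →
                            BalancedChildren (length f) h (insertBelow* x c f)
    Balanced-insertBelow* x c [] bc bf = Balanced-absorb (Balanced-insertBelow x c bc) bf
    Balanced-insertBelow* x c ((k , d) ∷ f) bc (bd ∷ bf) with x <ₖ? k
    ... | yes _ = Balanced-absorb (Balanced-insertBelow x c bc) (bd ∷ bf)
    ... | no  _ = let (n≤ , ≤n , bd′ , bf′) = Balanced-insertBelow* x d f bd bf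
                  in s≤s n≤ , s≤s ≤n , bc , bd′ ∷ bf′

  Balanced-insert : 1 ≤ m → ∀ {h} x t → Balanced 1 h t → ∃[ h′ ] Balanced 1 h′ (insert x t)
  Balanced-insert 1≤m x t b with insertBelow x t | Balanced-insertBelow x t b
  ... | intact _    | intact b′   = _ , b′
  -- The new root has a single key, within the bound 2m because m ≥ 1.
  ... | split _ _ _ | split bc bd = _ , Balanced-node (s≤s z≤n) (≤-trans 1≤m m≤2m) bc (bd ∷ [])

  insertBTree : 1 ≤ m → ∀ x (T : BTree) → All (λ k → ¬ x ≈ₖ k) (keys (tree T)) → BTree
  insertBTree 1≤m x T x∉T = record
    { tree    = insert x (tree T)
    ; isBTree = record
      { ordered       = Ordered-insert (tree T) x∉T (IsBTree.ordered (isBTree T))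
      ; nodeSizes     = proj₁ (proj₂ balanced)
      ; leavesAtDepth = _ , proj₂ (proj₂ balanced)
      }
    }
    where
    balanced = Balanced-insert 1≤m x (tree T)
      (IsBTree.nodeSizes (isBTree T) , proj₂ (IsBTree.leavesAtDepth (isBTree T)))

  -- Every leaf can receive a new key.

  Between : Key → Key → Key → Set ℓ₂
  Between lo hi x = lo <ₖ x × x <ₖ hi

  FreeKey : Key → Key → List Key → Key → Set (c ⊔ ℓ₁ ⊔ ℓ₂)
  FreeKey lo hi ks x = Between lo hi x × All (λ k → ¬ x ≈ₖ k) ks

  <⇒≉ₖ : ∀ {x k} → x <ₖ k → ¬ x ≈ₖ k
  <⇒≉ₖ x<k x≈k = <-irreflₖ x≈k x<k

  >⇒≉ₖ : ∀ {x k} → k <ₖ x → ¬ x ≈ₖ k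
  >⇒≉ₖ k<x x≈k = <-irreflₖ (Eqₖ.sym x≈k) k<x

  denseₖ : ∀ {x y} → x <ₖ y → ∃ (Between x y)
  denseₖ = DenseLinearOrder.dense (KeyOrder.denseLinearOrder K)

  mutual
    -- Each separator on the way to the i-th leaf narrows the interval from `lo` to `hi`, which also
    -- keeps the key distinct from those on the other side. In the leaf, density provides a key
    -- below all keys present.
    freeKey : ∀ {lo hi} t → AllPairs _<ₖ_ (keys t) → All (Between lo hi) (keys t) → lo <ₖ hi →
              (i : Fin (leaves t)) → ∃[ x ] FreeKey lo hi (keys t) x × leafOf x t ≡ i
    freeKey (leaf []) _ _ lo<hi zero = let (x , b) = denseₖ lo<hi in x , (b , []) , refl
    freeKey (leaf (k ∷ ks)) (k<ks ∷ _) ((lo<k , k<hi) ∷ _) lo<hi zero =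
      let (x , lo<x , x<k) = denseₖ lo<k
      in x , ((lo<x , <-transₖ x<k k<hi) , <⇒≉ₖ x<k ∷ All.map (λ k<l → <⇒≉ₖ (<-transₖ x<k k<l)) k<ks) , refl
    freeKey (node c f) = freeKey* c f

    freeKey* : ∀ {lo hi} c f → AllPairs _<ₖ_ (keysF (c , f)) → All (Between lo hi) (keysF (c , f)) → lo <ₖ hi →
               (i : Fin (leaves* c f)) → ∃[ x ] FreeKey lo hi (keysF (c , f)) x × leafOf* x c f ≡ i
    freeKey* c [] <c bc lo<hi i rewrite List.++-identityʳ (keys c) = freeKey c <c bc lo<hi i
    freeKey* c ((k , d) ∷ f) <cf bcf lo<hi i
      with AllPairs-++⁻ {keys c} <cf | All.++⁻ (keys c) bcf | splitAt (leaves c) i in eq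
    ... | <c , (k<df ∷ _) , c<df | bc , (lo<k , k<hi) ∷ _ | inj₁ j =
      let (x , ((lo<x , x<k) , x∉c) , eq′) = freeKey c <c
            (All.zipWith (λ ((lo<l , _) , l<) → lo<l , All.head l<) (bc , c<df)) lo<k j
      in x , ((lo<x , <-transₖ x<k k<hi) ,
              All.++⁺ x∉c (<⇒≉ₖ x<k ∷ All.map (λ k<l → <⇒≉ₖ (<-transₖ x<k k<l)) k<df)) ,
         trans (goesLeft x<k) (trans (cong (_↑ˡ leaves* d f) eq′) (splitAt⁻¹-↑ˡ eq))
      where
      goesLeft : ∀ {x} → x <ₖ k → leafOf* x c ((k , d) ∷ f) ≡ leafOf x c ↑ˡ leaves* d f
      goesLeft {x} x<k with x <ₖ? k
      ... | yes _  = refl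
      ... | no x≮k = contradiction x<k x≮k
    ... | _ , (k<df ∷ <df) , c<df | _ , (lo<k , k<hi) ∷ bdf | inj₂ j =
      let (x , ((k<x , x<hi) , x∉df) , eq′) = freeKey* d f <df
            (All.zipWith (λ ((_ , l<hi) , k<l) → k<l , l<hi) (bdf , k<df)) k<hi j
      in x , ((<-transₖ lo<k k<x , x<hi) ,
              All.++⁺ (All.map (λ l< → >⇒≉ₖ (<-transₖ (All.head l<) k<x)) c<df) (>⇒≉ₖ k<x ∷ x∉df)) ,
         trans (goesRight k<x) (trans (cong (leaves c ↑ʳ_) eq′) (splitAt⁻¹-↑ʳ eq))
      where
      goesRight : ∀ {x} → k <ₖ x → leafOf* x c ((k , d) ∷ f) ≡ leaves c ↑ʳ leafOf* x d f
      goesRight {x} k<x with x <ₖ? k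
      ... | yes x<k = contradiction k<x (<⇒≯ₖ x<k)
      ... | no _    = refl

  lowerBound : ∀ ks → ∃[ lo ] All (lo <ₖ_) ks
  lowerBound []       = KeyOrder.key K , []
  lowerBound (k ∷ ks) with lowerBound ks
  ... | lo , lo<ks with lo <ₖ? k
  ...   | yes lo<k = lo , lo<k ∷ lo<ks
  ...   | no  lo≮k = let (l , l<k) = KeyOrder.noLeast K k
                     in l , l<k ∷ All.map (<-transₖ (<∧≮⇒<ₖ l<k lo≮k)) lo<ks

  upperBound : ∀ ks → ∃[ hi ] All (_<ₖ hi) ks
  upperBound []       = KeyOrder.key K , []
  upperBound (k ∷ ks) with upperBound ks
  ... | hi , ks<hi with KeyOrder.noGreatest K k
  ...   | h , k<h with h <ₖ? hi
  ...     | yes h<hi = hi , <-transₖ k<h h<hi ∷ ks<hi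
  ...     | no  h≮hi = h , k<h ∷ All.map (λ l<hi → <∧≮⇒<ₖ l<hi h≮hi) ks<hi

  insertableAt : (t : Tree Key) → Ordered t → (i : Fin (leaves t)) →
                 ∃[ x ] All (λ k → ¬ x ≈ₖ k) (keys t) × leafOf x t ≡ i
  -- Adding a fixed key to both lists gives `lo <ₖ hi` without a case distinction on the keys of
  -- `t`.
  insertableAt t o i with lowerBound (KeyOrder.key K ∷ keys t) | upperBound (KeyOrder.key K ∷ keys t)
  ... | lo , lo<key ∷ lo<t | hi , key<hi ∷ t<hi =
    let (x , (_ , x∉t) , eq) = freeKey t (Ordered⇒AllPairs t o) (All.zip (lo<t , t<hi)) (<-transₖ lo<key key<hi) i
    in x , x∉t , eq

-- Heights of external vertices under placement.

module Placement (m : ℕ) where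

  open HistoricTrees m

  slots-branching : ∀ {h} → Branching h → slots h ≡ 2
  slots-branching {h} b rewrite dec-true (branching? h) b = refl

  slots-nonbranching : ∀ {h} → ¬ Branching h → slots h ≡ 1
  slots-nonbranching {h} ¬b rewrite dec-false (branching? h) ¬b = refl

  mutual
    heights : ∀ {h} → Slot h → List ℕ
    heights {h} external      = h ∷ []
    heights     (vertex _ ss) = heights* ss

    heights* : ∀ {h n} → Vec (Slot h) n → List ℕ
    heights* []       = []
    heights* (s ∷ ss) = heights s ++ heights* ss

  mutual
    length-heights : ∀ {h} (s : Slot h) → length (heights s) ≡ externals s
    length-heights external      = refl
    length-heights (vertex _ ss) = length-heights* ss

    length-heights* : ∀ {h n} (ss : Vec (Slot h) n) → length (heights* ss) ≡ externals* ss
    length-heights* []       = refl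
    length-heights* (s ∷ ss) = trans (List.length-++ (heights s)) (cong₂ _+_ (length-heights s) (length-heights* ss))

  heights*-replicate : ∀ n {h} → heights* (Vec.replicate n (external {h})) ≡ List.replicate n h
  heights*-replicate zero    = refl
  heights*-replicate (suc n) = cong (_ ∷_) (heights*-replicate n)

  labels*-replicate : ∀ n {h} → labels* (Vec.replicate n (external {h})) ≡ []
  labels*-replicate zero    = refl
  labels*-replicate (suc n) = labels*-replicate n

  -- The counterpart of `bump`: an occupied slot is replaced by the empty child slots of its new
  -- vertex.
  grow : ℕ → List ℕ
  grow h = List.replicate (slots h) (suc h)

  mutual
    heights-place : ∀ {h} l (s : Slot h) j → heights (place l s j) ≡ expandAt grow (toℕ j) (heights s)
    heights-place {h} l external      zero = trans (heights*-replicate (slots h)) (sym (List.++-identityʳ (grow h)))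
    heights-place     l (vertex _ ss) j    = heights*-place l ss j

    heights*-place : ∀ {h n} l (ss : Vec (Slot h) n) j →
                     heights* (place* l ss j) ≡ expandAt grow (toℕ j) (heights* ss)
    heights*-place l (s ∷ ss) i with splitAt (externals s) i in eq
    ... | inj₁ j = begin
      heights (place l s j) ++ heights* ss             ≡⟨ cong (_++ heights* ss) (heights-place l s j) ⟩
      expandAt grow (toℕ j) (heights s) ++ heights* ss
        ≡⟨ expandAt-++ˡ grow (heights s) (heights* ss) (subst (toℕ j <_) (sym (length-heights s)) (toℕ<n j)) ⟨
      expandAt grow (toℕ j) (heights s ++ heights* ss)
        ≡⟨ cong (λ k → expandAt grow k (heights s ++ heights* ss))
             (trans (sym (toℕ-↑ˡ j (externals* ss))) (cong toℕ (splitAt⁻¹-↑ˡ eq))) ⟩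
      expandAt grow (toℕ i) (heights s ++ heights* ss) ∎
      where open ≡-Reasoning
    ... | inj₂ j = begin
      heights s ++ heights* (place* l ss j)             ≡⟨ cong (heights s ++_) (heights*-place l ss j) ⟩
      heights s ++ expandAt grow (toℕ j) (heights* ss)  ≡⟨ expandAt-++ʳ grow (heights s) (heights* ss) ⟨
      expandAt grow (length (heights s) + toℕ j) (heights s ++ heights* ss)
        ≡⟨ cong (λ k → expandAt grow k (heights s ++ heights* ss))
             (trans (cong (_+ toℕ j) (length-heights s))
                    (trans (sym (toℕ-↑ʳ (externals s) j)) (cong toℕ (splitAt⁻¹-↑ʳ eq)))) ⟩
      expandAt grow (toℕ i) (heights s ++ heights* ss)  ∎
      where open ≡-Reasoning

  -- Labels under placement.

  mutual
    labels-place : ∀ {h} l (s : Slot h) j → labels (place l s j) ↭ l ∷ labels s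
    labels-place {h} l external j = ↭-reflexive (cong (l ∷_) (labels*-replicate (slots h)))
    labels-place l (vertex k ss) j = ↭-trans (prep k (labels*-place l ss j)) (swap k l ↭-refl)

    labels*-place : ∀ {h n} l (ss : Vec (Slot h) n) j → labels* (place* l ss j) ↭ l ∷ labels* ss
    labels*-place l (s ∷ ss) i with splitAt (externals s) i
    ... | inj₁ j = ↭.++⁺ʳ (labels* ss) (labels-place l s j)
    ... | inj₂ j = ↭-trans (↭.++⁺ˡ (labels s) (labels*-place l ss j)) (↭.shift l (labels s) (labels* ss))

  LabelAbove-place⁺ : ∀ {h k l} (s : Slot h) j → k < l → LabelAbove k s → LabelAbove k (place l s j)
  LabelAbove-place⁺ external      j k<l _            = vertex k<l
  LabelAbove-place⁺ (vertex _ ss) j k<l (vertex k<l′) = vertex k<l′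

  LabelAbove-place⁻ : ∀ {h k l} (s : Slot h) j → LabelAbove k (place l s j) → LabelAbove k s
  LabelAbove-place⁻ external      j _            = external
  LabelAbove-place⁻ (vertex _ ss) j (vertex k<l) = vertex k<l

  LabelAbove*-place⁺ : ∀ {h n k l} (ss : Vec (Slot h) n) j → k < l →
                       VecAll (LabelAbove k) ss → VecAll (LabelAbove k) (place* l ss j)
  LabelAbove*-place⁺ (s ∷ ss) i k<l (as ∷ ass) with splitAt (externals s) i
  ... | inj₁ j = LabelAbove-place⁺ s j k<l as ∷ ass
  ... | inj₂ j = as ∷ LabelAbove*-place⁺ ss j k<l ass

  LabelAbove*-place⁻ : ∀ {h n k l} (ss : Vec (Slot h) n) j →
                       VecAll (LabelAbove k) (place* l ss j) → VecAll (LabelAbove k) ss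
  LabelAbove*-place⁻ (s ∷ ss) i a with splitAt (externals s) i
  LabelAbove*-place⁻ (s ∷ ss) i (as ∷ ass) | inj₁ j = LabelAbove-place⁻ s j as ∷ ass
  LabelAbove*-place⁻ (s ∷ ss) i (as ∷ ass) | inj₂ j = as ∷ LabelAbove*-place⁻ ss j ass

  replicate-external : ∀ n {h} (P : Slot h → Set) → P external → VecAll P (Vec.replicate n external)
  replicate-external zero    P p = []
  replicate-external (suc n) P p = p ∷ replicate-external n P p

  mutual
    -- The new vertex has no children, and its label exceeds all labels above it.
    Increasing-place⁺ : ∀ {h l} (s : Slot h) j → All (_< l) (labels s) →
                        Increasing s → Increasing (place l s j)
    Increasing-place⁺ external j _ _ =
      vertex (replicate-external _ _ external) (replicate-external _ _ external)
    Increasing-place⁺ (vertex k ss) j (k<l ∷ ss<l) (vertex a inc) =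
      vertex (LabelAbove*-place⁺ ss j k<l a) (Increasing*-place⁺ ss j ss<l inc)

    Increasing*-place⁺ : ∀ {h n l} (ss : Vec (Slot h) n) j → All (_< l) (labels* ss) →
                         VecAll Increasing ss → VecAll Increasing (place* l ss j)
    Increasing*-place⁺ (s ∷ ss) i <l (inc ∷ incs) with splitAt (externals s) i
    ... | inj₁ j = Increasing-place⁺ s j (All.++⁻ˡ (labels s) <l) inc ∷ incs
    ... | inj₂ j = inc ∷ Increasing*-place⁺ ss j (All.++⁻ʳ (labels s) <l) incs

  mutual
    Increasing-place⁻ : ∀ {h l} (s : Slot h) j → Increasing (place l s j) → Increasing s
    Increasing-place⁻ external      j _              = external
    Increasing-place⁻ (vertex k ss) j (vertex a inc) =
      vertex (LabelAbove*-place⁻ ss j a) (Increasing*-place⁻ ss j inc)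

    Increasing*-place⁻ : ∀ {h n l} (ss : Vec (Slot h) n) j →
                         VecAll Increasing (place* l ss j) → VecAll Increasing ss
    Increasing*-place⁻ (s ∷ ss) i inc with splitAt (externals s) i
    Increasing*-place⁻ (s ∷ ss) i (inc ∷ incs) | inj₁ j = Increasing-place⁻ s j inc ∷ incs
    Increasing*-place⁻ (s ∷ ss) i (inc ∷ incs) | inj₂ j = inc ∷ Increasing*-place⁻ ss j incs

  -- The left tree contains the label `l`, the right one only smaller labels. Thus equal results
  -- cannot have `l` in different slots.
  place-fresh : ∀ {h l} (s s′ : Slot h) j → All (_< l) (labels s′) → place l s j ≢ s′
  place-fresh {l = l} s s′ j s′<l refl = <-irrefl refl (All.head (↭.All-resp-↭ (labels-place l s j) s′<l))

  vertex-injective : ∀ {h k k′} {ss ss′ : Vec (Slot (suc h)) (slots h)} →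
                     _≡_ {A = Slot h} (vertex k ss) (vertex k′ ss′) → k ≡ k′ × ss ≡ ss′
  vertex-injective refl = refl , refl

  -- Undoing a placement.

  mutual
    -- The label `l` is larger than all others, so the result shows which vertex is new. Positions
    -- are compared as numbers because their `Fin` types agree only once the trees do.
    place-injective : ∀ {h l} (s s′ : Slot h) {j j′} → All (_< l) (labels s) → All (_< l) (labels s′) →
                      place l s j ≡ place l s′ j′ → s ≡ s′ × toℕ j ≡ toℕ j′
    place-injective external      external       {zero} {zero} _ _ _ = refl , refl
    place-injective external      (vertex _ _) _ (k<l ∷ _) eq =
      contradiction (proj₁ (vertex-injective (sym eq))) (<⇒≢ k<l)
    place-injective (vertex _ _)  external     (k<l ∷ _) _ eq =
      contradiction (proj₁ (vertex-injective eq)) (<⇒≢ k<l)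
    place-injective (vertex k ss) (vertex k′ ss′) (_ ∷ ss<l) (_ ∷ ss′<l) eq =
      let (k≡k′ , eq*) = vertex-injective eq
          (ss≡ss′ , j≡j′) = place*-injective ss ss′ ss<l ss′<l eq*
      in cong₂ vertex k≡k′ ss≡ss′ , j≡j′

    place*-injective : ∀ {h n l} (ss ss′ : Vec (Slot h) n) {j j′} →
                       All (_< l) (labels* ss) → All (_< l) (labels* ss′) →
                       place* l ss j ≡ place* l ss′ j′ → ss ≡ ss′ × toℕ j ≡ toℕ j′
    place*-injective (s ∷ ss) (s′ ∷ ss′) {i} {i′} <l <l′ eq
      with All.++⁻ (labels s) <l | All.++⁻ (labels s′) <l′
         | splitAt (externals s) i in e | splitAt (externals s′) i′ in e′
    ... | s<l , _ | s′<l , _ | inj₁ j | inj₁ j′ =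
      let (s≡s′ , j≡j′) = place-injective s s′ s<l s′<l (Vec.∷-injectiveˡ eq)
      in cong₂ _∷_ s≡s′ (Vec.∷-injectiveʳ eq) , (begin
        toℕ i                       ≡⟨ cong toℕ (splitAt⁻¹-↑ˡ e) ⟨
        toℕ (j ↑ˡ externals* ss)    ≡⟨ toℕ-↑ˡ j _ ⟩
        toℕ j                       ≡⟨ j≡j′ ⟩
        toℕ j′                      ≡⟨ toℕ-↑ˡ j′ _ ⟨
        toℕ (j′ ↑ˡ externals* ss′)  ≡⟨ cong toℕ (splitAt⁻¹-↑ˡ e′) ⟩
        toℕ i′                      ∎)
      where open ≡-Reasoning
    ... | _ , ss<l | _ , ss′<l | inj₂ j | inj₂ j′ =
      let (ss≡ss′ , j≡j′) = place*-injective ss ss′ ss<l ss′<l (Vec.∷-injectiveʳ eq)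
      in cong₂ _∷_ (Vec.∷-injectiveˡ eq) ss≡ss′ , (begin
        toℕ i                     ≡⟨ cong toℕ (splitAt⁻¹-↑ʳ e) ⟨
        toℕ (externals s ↑ʳ j)    ≡⟨ toℕ-↑ʳ (externals s) j ⟩
        externals s + toℕ j       ≡⟨ cong₂ _+_ (cong externals (Vec.∷-injectiveˡ eq)) j≡j′ ⟩
        externals s′ + toℕ j′     ≡⟨ toℕ-↑ʳ (externals s′) j′ ⟨
        toℕ (externals s′ ↑ʳ j′)  ≡⟨ cong toℕ (splitAt⁻¹-↑ʳ e′) ⟩
        toℕ i′                    ∎)
      where open ≡-Reasoning
    ... | _ | s′<l , _ | inj₁ j | inj₂ j′ = contradiction (Vec.∷-injectiveˡ eq) (place-fresh s s′ j s′<l)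
    ... | s<l , _ | _ | inj₂ j | inj₁ j′ = contradiction (Vec.∷-injectiveˡ (sym eq)) (place-fresh s′ s j′ s<l)

  -- A vertex in one of the slots would have a label both above `l` and at most `l`. Hence the
  -- vertex with the largest label has no children and can be removed.
  external-unless-larger : ∀ {h n l} (ss : Vec (Slot h) n) → VecAll (LabelAbove l) ss →
                           All (_≤ l) (labels* ss) → ss ≡ Vec.replicate n external
  external-unless-larger []                  _                    _          = refl
  external-unless-larger (external ∷ ss)     (_ ∷ a)              ≤l         =
    cong (external ∷_) (external-unless-larger ss a ≤l)
  external-unless-larger (vertex _ _ ∷ ss)   (vertex l<k ∷ _)     (k≤l ∷ _)  =
    contradiction k≤l (<⇒≱ l<k)

  mutual
    -- The membership proof leads to the vertex labelled `l`, which is turned back into an external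
    -- vertex.
    unplace : ∀ {h l} (s : Slot h) → Increasing s → All (_≤ l) (labels s) → l ∈ labels s →
              ∃[ s′ ] ∃[ j ] place l s′ j ≡ s
    unplace (vertex l ss) (vertex a _) (_ ∷ ss≤l) (here refl) =
      external , zero , cong (vertex l) (sym (external-unless-larger ss a ss≤l))
    unplace (vertex k ss) (vertex _ inc) (_ ∷ ss≤l) (there l∈ss) =
      let (ss′ , j , eq) = unplace* ss inc ss≤l l∈ss in vertex k ss′ , j , cong (vertex k) eq

    unplace* : ∀ {h n l} (ss : Vec (Slot h) n) → VecAll Increasing ss → All (_≤ l) (labels* ss) →
               l ∈ labels* ss → ∃[ ss′ ] ∃[ j ] place* l ss′ j ≡ ss
    unplace* {l = l} (s ∷ ss) (inc ∷ incs) ≤l l∈ with ∈-++⁻ (labels s) l∈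
    ... | inj₁ l∈s =
      let (s′ , j , eq) = unplace s inc (All.++⁻ˡ (labels s) ≤l) l∈s
      in s′ ∷ ss , j ↑ˡ externals* ss , trans (left s′ j) (cong (_∷ ss) eq)
      where
      left : ∀ s′ j → place* l (s′ ∷ ss) (j ↑ˡ externals* ss) ≡ place l s′ j ∷ ss
      left s′ j rewrite splitAt-↑ˡ (externals s′) j (externals* ss) = refl
    ... | inj₂ l∈ss =
      let (ss′ , j , eq) = unplace* ss incs (All.++⁻ʳ (labels s) ≤l) l∈ss
      in s ∷ ss′ , externals s ↑ʳ j , trans (right ss′ j) (cong (s ∷_) eq)
      where
      right : ∀ ss′ j → place* l (s ∷ ss′) (externals s ↑ʳ j) ≡ s ∷ place* l ss′ j
      right ss′ j rewrite splitAt-↑ʳ (externals s) (externals* ss′) j = refl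

  -- Historic trees with one vertex more or less.

  labels<suc : ∀ {n} {H : Slot 0} → IsHistoric n H → All (_< suc n) (labels H)
  labels<suc {n} isH = ↭.All-resp-↭ (↭-sym (IsHistoric.labelled isH)) (All.applyUpTo⁺₁ suc n s≤s)

  applyUpTo-suc : ∀ n → applyUpTo suc (suc n) ↭ suc n ∷ applyUpTo suc n
  applyUpTo-suc n = ↭-trans (↭-reflexive (sym (List.applyUpTo-∷ʳ suc n))) (↭-sym (↭.∷↭∷ʳ (suc n) _))

  place-historic : ∀ {n H} j → IsHistoric n H → IsHistoric (suc n) (place (suc n) H j)
  place-historic {n} {H} j isH = record
    { labelled   = ↭-trans (labels-place (suc n) H j)
                     (↭-trans (prep (suc n) (IsHistoric.labelled isH)) (↭-sym (applyUpTo-suc n)))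
    ; increasing = Increasing-place⁺ H j (labels<suc isH) (IsHistoric.increasing isH)
    }

  unplace-historic : ∀ {n H} → IsHistoric (suc n) H →
                     ∃[ H′ ] ∃[ j ] IsHistoric n H′ × place (suc n) H′ j ≡ H
  unplace-historic {n} {H} isH
    with unplace H (IsHistoric.increasing isH) (All.map s≤s⁻¹ (labels<suc isH))
           (↭.∈-resp-↭ (↭-sym (↭-trans (IsHistoric.labelled isH) (applyUpTo-suc n))) (here refl))
  ... | H′ , j , refl = H′ , j , record
    -- With the largest label in front on both sides, it cancels.
    { labelled   = ↭.drop-∷ (↭-trans (↭-sym (labels-place (suc n) H′ j))
                     (↭-trans (IsHistoric.labelled isH) (applyUpTo-suc n)))
    ; increasing = Increasing-place⁻ H′ j (IsHistoric.increasing isH)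
    } , refl

-- Heights of external vertices against leaf sizes.

module Bijectivity {c ℓ₁ ℓ₂} (K : KeyOrder c ℓ₁ ℓ₂) (m : ℕ) (1≤m : 1 ≤ m) where

  open Correspondence K m
  open Insertion K m
  open Placement m
  open +-*-Solver using (solve; con; _:+_; _:*_; _:=_)

  -- h is the height of an external vertex and s the number of keys of the
  -- corresponding leaf; j counts the branchings above the external vertex,
  -- each of which stands for a split that left m keys in the leaf.
  Fits : ℕ → ℕ → Set
  Fits h s = s ≤ 2 * m × ∃[ j ] h ≡ s + j * (m + 1) × (j ≡ 0 ⊎ m ≤ s)

  -- Without earlier splits s is the height itself. Otherwise compare s + j(m + 1) = 2m + j′(m + 1):
  -- j > j′ is impossible, since m ≤ s would make the left side at least 2m + 1 + j′(m + 1), and j ≤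
  -- j′ gives s ≥ 2m.
  branching⇒full : ∀ {h s} → Fits h s → Branching h → 2 * m ≤ s
  branching⇒full {s = s} (_ , zero , h≡ , _) (j′ , refl) =
    ≤-trans (m≤m+n (2 * m) _) (≤-reflexive (trans h≡ (+-identityʳ s)))
  branching⇒full {s = s} (_ , suc j , h≡ , inj₂ m≤s) (j′ , refl) with suc j ≤? j′
  ... | yes j<j′ = +-cancelʳ-≤ (j′ * (m + 1)) _ _ (begin
    2 * m + j′ * (m + 1)     ≡⟨ h≡ ⟩
    s + suc j * (m + 1)      ≤⟨ +-monoʳ-≤ s (*-monoˡ-≤ (m + 1) j<j′) ⟩
    s + j′ * (m + 1)         ∎)
    where open ≤-Reasoning
  ... | no j≮j′ = contradiction (begin-strict
    2 * m + j′ * (m + 1)        ≤⟨ +-monoʳ-≤ (2 * m) (*-monoˡ-≤ (m + 1) (s≤s⁻¹ (≰⇒> j≮j′))) ⟩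
    2 * m + j * (m + 1)         <⟨ n<1+n _ ⟩
    suc (2 * m + j * (m + 1))   ≡⟨ solve 2 (λ x y → con 1 :+ (con 2 :* x :+ y :* (x :+ con 1)) :=
                                                    x :+ (con 1 :+ y) :* (x :+ con 1)) refl m j ⟩
    m + suc j * (m + 1)         ≤⟨ +-monoˡ-≤ (suc j * (m + 1)) m≤s ⟩
    s + suc j * (m + 1)         ≡⟨ h≡ ⟨
    2 * m + j′ * (m + 1)        ∎) (<-irrefl refl)
    where open ≤-Reasoning

  full⇒branching : ∀ {h s} → Fits h s → 2 * m ≤ s → Branching h
  full⇒branching (s≤2m , j , h≡ , _) 2m≤s = j , trans h≡ (cong (_+ j * (m + 1)) (≤-antisym s≤2m 2m≤s))

  -- Without a split, height and size both rise by one. In a split the size drops from 2m to m while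
  -- the height rises by one, and the difference m + 1 is accounted for by the additional branching.
  Fits-grow-bump : ∀ {h s} → Fits h s → Pointwise Fits (grow h) (bump s)
  Fits-grow-bump {h} {s} fits@(s≤2m , j , h≡ , j≡0⊎m≤s) with suc s ≤? 2 * m
  ... | yes s<2m rewrite slots-nonbranching (λ b → <⇒≱ s<2m (branching⇒full fits b)) =
    (s<2m , j , cong suc h≡ , Sum.map₂ m≤n⇒m≤1+n j≡0⊎m≤s) ∷ []
  ... | no s≮2m rewrite slots-branching (full⇒branching fits (s≤s⁻¹ (≰⇒> s≮2m))) =
    left ∷ subst (Fits (suc h)) (sym s∸m≡m) left ∷ []
    where
    s≡2m : s ≡ 2 * m
    s≡2m = ≤-antisym s≤2m (s≤s⁻¹ (≰⇒> s≮2m))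

    s∸m≡m : s ∸ m ≡ m
    s∸m≡m = trans (cong (_∸ m) s≡2m) (trans (m+n∸m≡n m (m + 0)) (+-identityʳ m))

    left : Fits (suc h) m
    left = m≤2m , suc j , (begin
      suc h                      ≡⟨ cong suc h≡ ⟩
      suc (s + j * (m + 1))      ≡⟨ cong (λ s → suc (s + j * (m + 1))) s≡2m ⟩
      suc (2 * m + j * (m + 1))  ≡⟨ solve 2 (λ x y → con 1 :+ (con 2 :* x :+ y :* (x :+ con 1)) :=
                                                    x :+ (con 1 :+ y) :* (x :+ con 1)) refl m j ⟩
      m + suc j * (m + 1)        ∎) , inj₂ ≤-refl
      where open ≡-Reasoning

  -- The first new size is s + 1 or, after a split, m. In the latter case s = m would mean s + 1 ≤
  -- 2m by m ≥ 1, so that no split takes place.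
  bump-≢ : ∀ s ys zs → bump s ++ ys ≢ s ∷ zs
  bump-≢ s ys zs eq with suc s ≤? 2 * m
  ... | yes _   = 1+n≢n (List.∷-injectiveˡ eq)
  ... | no s≮2m = s≮2m (subst (λ s → suc s ≤ 2 * m) (List.∷-injectiveˡ eq)
                        (≤-trans (+-monoˡ-≤ m 1≤m) (+-monoʳ-≤ m (m≤m+n m 0))))

  -- Φ as a relation: values, functionality, injectivity, totality and surjectivity.

  ¬Branching-0 : ¬ Branching 0
  -- Since 2m ≥ 1, the root has one child slot, in step with the single leaf of the first tree.
  ¬Branching-0 (j , eq) = <⇒≢ (≤-trans 1≤m (≤-trans m≤2m (m≤m+n (2 * m) _))) eq

  Φ-historic : ∀ {k H} {Ts : Vec BTree k} → Φ[ Ts ]= H → IsHistoric k H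
  -- The one-vertex tree is itself a placement, of label 1 into the empty slot at height 0.
  Φ-historic (start _) = place-historic {H = external} zero (record { labelled = ↭-refl ; increasing = external })
  Φ-historic (step {j = j} φ _ _) = place-historic j (Φ-historic φ)

  Φ-fits : ∀ {k T H} {Ts : Vec BTree k} → Φ[ T ∷ Ts ]= H → Pointwise Fits (heights H) (leafSizes (tree T))
  Φ-fits (start (x , refl)) rewrite heights*-replicate (slots 0) {1} | slots-nonbranching ¬Branching-0 =
    -- One key, height 1 and no branching so far.
    (≤-trans 1≤m m≤2m , 0 , refl , inj₁ refl) ∷ []
  Φ-fits {T = T′} (step {k} {T} {.T′} {H} {i} {j = j} φ (x , _ , leaf≡i , T′≡) i≡j) =
    subst₂ (Pointwise Fits) (sym (heights-place (suc (suc k)) H j))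
      (trans (cong (λ n → expandAt bump n (leafSizes (tree T))) (trans (sym i≡j) (cong toℕ (sym leaf≡i))))
        (sym (trans (cong leafSizes T′≡) (leafSizes-insert x (tree T)))))
      (expandAt-pointwise Fits-grow-bump (toℕ j) (Φ-fits φ))

  -- This makes the recursion well defined: `Φ-fits` pairs external vertices with leaves one to one.
  Φ-externals : ∀ {k T H} {Ts : Vec BTree k} → Φ[ T ∷ Ts ]= H → externals H ≡ leaves (tree T)
  Φ-externals {T = T} {H} φ = begin
    externals H                  ≡⟨ length-heights H ⟨
    length (heights H)           ≡⟨ Pointwise.Pointwise-length (Φ-fits φ) ⟩
    length (leafSizes (tree T))  ≡⟨ length-leafSizes (tree T) ⟩
    leaves (tree T)              ∎
    where open ≡-Reasoning

  shapes : ∀ {k} → Vec BTree k → Vec (Tree ⊤) k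
  shapes = Vec.map (λ T → shape (tree T))

  leafSizes-⟶ : ∀ {T i T′} → T ⟶[ i ] T′ → leafSizes (tree T′) ≡ expandAt bump (toℕ i) (leafSizes (tree T))
  leafSizes-⟶ {T} (x , _ , refl , T′≡) = trans (cong leafSizes T′≡) (leafSizes-insert x (tree T))

  shape-⟶ : ∀ {T i T′} → T ⟶[ i ] T′ → shape (tree T′) ≡ root (insertAt (toℕ i) (shape (tree T)))
  shape-⟶ {T} (x , _ , refl , T′≡) = trans (cong shape T′≡) (shape-insert x (tree T))

  -- Shapes fix the leaf sizes before and after the step, and these reveal the position by
  -- `expandAt-injective`, whichever key was inserted.
  ⟶-index-unique : ∀ {T₁ T₂ i₁ i₂ T₁′ T₂′} → T₁ ⟶[ i₁ ] T₁′ → T₂ ⟶[ i₂ ] T₂′ →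
                   T₁ ≅ T₂ → T₁′ ≅ T₂′ → toℕ i₁ ≡ toℕ i₂
  ⟶-index-unique {T₁} {T₂} {i₁} {i₂} {T₁′} {T₂′} s₁ s₂ T₁≅T₂ T₁′≅T₂′ =
    expandAt-injective bump bump-≢ (leafSizes (tree T₁))
      (subst (toℕ i₁ <_) (sym (length-leafSizes (tree T₁))) (toℕ<n i₁))
      (subst (toℕ i₂ <_) (trans (sym (length-leafSizes (tree T₂))) (cong length (sym sizes≡))) (toℕ<n i₂))
      (begin
        expandAt bump (toℕ i₁) (leafSizes (tree T₁)) ≡⟨ leafSizes-⟶ {T₁} {i₁} {T₁′} s₁ ⟨
        leafSizes (tree T₁′)                         ≡⟨ leafSizes-≅ T₁′ T₂′ T₁′≅T₂′ ⟩
        leafSizes (tree T₂′)                         ≡⟨ leafSizes-⟶ {T₂} {i₂} {T₂′} s₂ ⟩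
        expandAt bump (toℕ i₂) (leafSizes (tree T₂)) ≡⟨ cong (expandAt bump (toℕ i₂)) sizes≡ ⟨
        expandAt bump (toℕ i₂) (leafSizes (tree T₁)) ∎)
    where
    open ≡-Reasoning
    sizes≡ = leafSizes-≅ T₁ T₂ T₁≅T₂

  -- Histories count as equal when their shapes agree, so the value must not depend on the actual
  -- keys. Inductively the earlier historic trees agree, and the last position does by
  -- `⟶-index-unique`.
  Φ-functional : ∀ {k H₁ H₂} {Ts₁ Ts₂ : Vec BTree k} → Φ[ Ts₁ ]= H₁ → Φ[ Ts₂ ]= H₂ →
                 shapes Ts₁ ≡ shapes Ts₂ → H₁ ≡ H₂
  Φ-functional (start _) (start _) _ = refl
  Φ-functional (step {k} {T₁} {T₁′} {H} φ₁ s₁ i₁≡j₁) (step {T = T₂} {T₂′} φ₂ s₂ i₂≡j₂) eq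
    with refl ← Φ-functional φ₁ φ₂ (Vec.∷-injectiveʳ eq) =
    cong (place (suc (suc k)) H) (toℕ-injective (trans (sym i₁≡j₁) (trans
      (⟶-index-unique {T₁} {T₂} {T₁′ = T₁′} {T₂′} s₁ s₂
        (Vec.∷-injectiveˡ (Vec.∷-injectiveʳ eq)) (Vec.∷-injectiveˡ eq))
      i₂≡j₂)))

  -- Undoing the last placement yields equal earlier historic trees and positions; the earlier
  -- shapes agree by induction, and `shape-⟶` determines the last one.
  Φ-injective : ∀ {k H₁ H₂} {Ts₁ Ts₂ : Vec BTree k} → Φ[ Ts₁ ]= H₁ → Φ[ Ts₂ ]= H₂ →
                H₁ ≡ H₂ → shapes Ts₁ ≡ shapes Ts₂
  Φ-injective (start (_ , T₁≡)) (start (_ , T₂≡)) _ =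
    cong (_∷ []) (trans (cong shape T₁≡) (sym (cong shape T₂≡)))
  Φ-injective (step {T = T₁} {T₁′} {H₁} {i₁} φ₁ s₁ i₁≡j₁) (step {T = T₂} {T₂′} {H₂} {i₂} φ₂ s₂ i₂≡j₂) eq
    with place-injective H₁ H₂ (labels<suc (Φ-historic φ₁)) (labels<suc (Φ-historic φ₂)) eq
  ... | H₁≡H₂ , j₁≡j₂ = cong₂ _∷_ (begin
      shape (tree T₁′)                              ≡⟨ shape-⟶ {T₁} {i₁} {T₁′} s₁ ⟩
      root (insertAt (toℕ i₁) (shape (tree T₁)))
        ≡⟨ cong₂ (λ i t → root (insertAt i t)) (trans i₁≡j₁ (trans j₁≡j₂ (sym i₂≡j₂))) (Vec.∷-injectiveˡ shapes≡) ⟩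
      root (insertAt (toℕ i₂) (shape (tree T₂)))    ≡⟨ shape-⟶ {T₂} {i₂} {T₂′} s₂ ⟨
      shape (tree T₂′)                              ∎)
    shapes≡
    where
    open ≡-Reasoning
    shapes≡ = Φ-injective φ₁ φ₂ H₁≡H₂

  Φ-total : ∀ {k} {Ts : Vec BTree k} → IsHistory Ts → ∃[ H ] Φ[ Ts ]= H
  Φ-total (start one) = _ , start one
  Φ-total (step {i = i} h s) =
    let (H , φ) = Φ-total h
        leaves≡ = sym (Φ-externals φ)
    in _ , step {j = cast leaves≡ i} φ s (sym (toℕ-cast leaves≡ i))

  singleton : BTree
  singleton = record
    { tree    = leaf (KeyOrder.key K ∷ [])
    ; isBTree = record
      { ordered       = [] ∷ []
      ; nodeSizes     = leaf (s≤s z≤n) (≤-trans 1≤m m≤2m)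
      ; leavesAtDepth = 0 , leaf
      }
    }

  -- Removing the largest label leaves a smaller historic tree and a position. A history for the
  -- former is extended by a key that goes into the leaf at that position.
  Φ-onto : ∀ {k H} → IsHistoric (suc k) H → ∃[ Ts ] IsHistory {suc k} Ts × Φ[ Ts ]= H
  Φ-onto {zero} isH with unplace-historic isH
  ... | external   , zero , _    , refl = singleton ∷ [] , start (_ , refl) , start (_ , refl)
  -- A historic tree without labels has no vertex.
  ... | vertex _ _ , _    , isH′ , _    with () ← ↭.↭-length (IsHistoric.labelled isH′)
  Φ-onto {suc k} isH with unplace-historic isH
  ... | H′ , j , isH′ , refl with Φ-onto isH′
  ...   | T ∷ Ts , h , φ =
    let i              = cast (Φ-externals φ) j
        (x , x∉T , eq) = insertableAt (tree T) (IsBTree.ordered (isBTree T)) i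
        T⟶T′           = x , x∉T , eq , refl
    in insertBTree 1≤m x T x∉T ∷ T ∷ Ts , step h T⟶T′ , step φ T⟶T′ (toℕ-cast (Φ-externals φ) j)

-- Φ as a bijection of setoids.

theorem1 : ∀ {c ℓ₁ ℓ₂} (K : KeyOrder c ℓ₁ ℓ₂) (m n : ℕ) → 1 ≤ m → 1 ≤ n →
    let open Correspondence K m in
    (∀ {k} (T : BTree) (Ts : Vec BTree k) (H : Slot 0) →
    suc k ≤ n → IsHistory (T ∷ Ts) → Φ[ T ∷ Ts ]= H →
    externals H ≡ leaves (tree T))
    ×
    (Σ[ Φ ∈ Bijection (historySetoid n) (historicSetoid n) ]
    (∀ (𝒯 : History n) (H : Slot 0) →
    (Φ[ proj₁ 𝒯 ]= H) ⇔ (proj₁ (Bijection.to Φ 𝒯) ≡ H)))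
theorem1 K m (suc n) 1≤m _ = (λ _ _ _ _ _ φ → Φ-externals φ) , record
  { to        = λ (_ , h) → proj₁ (Φ-total h) , Φ-historic (proj₂ (Φ-total h))
  ; cong      = λ {(_ , h₁)} {(_ , h₂)} → Φ-functional (proj₂ (Φ-total h₁)) (proj₂ (Φ-total h₂))
  ; bijective =
      (λ {(_ , h₁)} {(_ , h₂)} → Φ-injective (proj₂ (Φ-total h₁)) (proj₂ (Φ-total h₂))) ,
      -- Setoid surjectivity concerns every history with the same shapes as `Ts`; `Φ-functional`
      -- treats them all at once.
      λ (_ , isH) → let (Ts , h , φ) = Φ-onto isH
                    in (Ts , h) , λ {(_ , h′)} → Φ-functional (proj₂ (Φ-total h′)) φ
  } , λ (_ , h) H → mk⇔
    (λ φ → Φ-functional (proj₂ (Φ-total h)) φ refl)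
    (λ eq → subst (Φ[ _ ]=_) eq (proj₂ (Φ-total h)))
  where open Correspondence K m
        open Bijectivity K m 1≤m
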